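{- $T$ is a complete theory: for every proposition (formula without free variables) $\varphi$ over $S$, one and only one of the properties $T\models\varphi$, $T\models\neg\varphi$ holds.
   Context: Let $F$ be a set of function symbols, each with an arity, containing infinitely many non-constant function symbols and at least one constant. Let $\mathrm{finite}$ be a unary relation symbol and $S=F\cup\{\mathrm{finite}\}$. The theory $T$ (in first-order logic with equality over $S$) has as axioms all propositions of the forms: [1] $\forall\bar x\forall\bar y\ \neg(f(\bar x)=g(\bar y))$; [2] $\forall\bar x\forall\bar y\ f(\bar x)=f(\bar y)\rightarrow\bigwedge_i x_i=y_i$; [3] $\forall\bar x\exists!\bar z\ \bigwedge_i z_i=t_i[\bar x\bar z]$; [4] $\forall\bar x\forall u\ \neg(u=t[u,\bar x]\wedge\mathrm{finite}(u))$; [5] $\forall\bar x\forall u\ (u=f(\bar x)\wedge\mathrm{finite}(u))\leftrightarrow(u=f(\bar x)\wedge\bigwedge_i\mathrm{finite}(x_i))$; where $f,g$ are distinct symbols of $F$, $\bar x,\bar y$ are vectors of (possibly non-distinct) variables, $\bar z$ is a vector of distinct variables, $t_i[\bar x\bar z]$ is one symbol of $F$ applied to variables from $\bar x$ or $\bar z$, and $t[u,\bar x]$ is a term containing at least one occurrence of a symbol of $F$ and the variable $u$, and possibly other variables of $\bar x$. -}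

module Defs where


open import Level using (Level)
open import Data.Nat using (ℕ; zero; suc; _+_; NonZero)
open import Data.Fin using (Fin; zero; suc; _↑ˡ_; _↑ʳ_; splitAt)
open import Data.Vec.Functional using (Vector; _∷_; [])
import Data.Vec.Functional as Vector
open import Data.List using (List)
open import Data.List.Membership.Propositional using (_∈_)
open import Data.Product using (∃; ∃-syntax; _×_)
open import Data.Sum using (_⊎_; [_,_]′)
open import Data.Unit.Polymorphic using (⊤)
open import Data.Empty.Polymorphic using (⊥)
open import Function using (_∘_)
open import Relation.Binary.Bundles using (Setoid)
open import Relation.Binary.PropositionalEquality using (_≡_; _≢_)
open import Relation.Nullary using (¬_)

record FunctionSymbols (ℓ : Level) : Set (Level.suc ℓ) where
  field
    Symbol : Set ℓ
    arity  : Symbol → ℕ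

open FunctionSymbols

InfinitelyManyNonConstants : ∀ {ℓ} → FunctionSymbols ℓ → Set ℓ
InfinitelyManyNonConstants F =
  ¬ (∃[ fs ] (∀ (f : Symbol F) → NonZero (arity F f) → f ∈ fs))

HasConstant : ∀ {ℓ} → FunctionSymbols ℓ → Set ℓ
HasConstant F = ∃[ c ] arity F c ≡ 0

-- Syntax.  Variables are de Bruijn indices: Term F n and Formula F n have
-- their free variables in Fin n.

data Term {ℓ} (F : FunctionSymbols ℓ) (n : ℕ) : Set ℓ where
  var : Fin n → Term F n
  app : (f : Symbol F) → Vector (Term F n) (arity F f) → Term F n

data _OccursIn_ {ℓ} {F : FunctionSymbols ℓ} {n : ℕ} (x : Fin n) : Term F n → Set ℓ where
  here  : x OccursIn var x
  there : ∀ {f} {ts : Vector (Term F n) (arity F f)} (i : Fin (arity F f)) →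
          x OccursIn ts i → x OccursIn app f ts

infix  9 _≐_
infix  8 ¬̇_
infixr 7 _∧̇_
infixr 6 _∨̇_
infixr 5 _⇒̇_
infix  4 _⇔̇_

data Formula {ℓ} (F : FunctionSymbols ℓ) : ℕ → Set ℓ where
  _≐_    : ∀ {n} → Term F n → Term F n → Formula F n
  finite : ∀ {n} → Term F n → Formula F n
  ⊤̇ ⊥̇    : ∀ {n} → Formula F n
  ¬̇_     : ∀ {n} → Formula F n → Formula F n
  _∧̇_ _∨̇_ _⇒̇_ _⇔̇_ : ∀ {n} → Formula F n → Formula F n → Formula F n
  all ex : ∀ {n} → Formula F (suc n) → Formula F n

Proposition : ∀ {ℓ} → FunctionSymbols ℓ → Set ℓ
Proposition F = Formula F 0

⋀ : ∀ {ℓ} {F : FunctionSymbols ℓ} {n k} → Vector (Formula F n) k → Formula F n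
⋀ = Vector.foldr _∧̇_ ⊤̇

renameTerm : ∀ {ℓ} {F : FunctionSymbols ℓ} {m n} → (Fin m → Fin n) → Term F m → Term F n
renameTerm r (var x)    = var (r x)
renameTerm r (app f ts) = app f (λ i → renameTerm r (ts i))

under : ∀ {m n} → (Fin m → Fin n) → Fin (suc m) → Fin (suc n)
under r zero    = zero
under r (suc x) = suc (r x)

rename : ∀ {ℓ} {F : FunctionSymbols ℓ} {m n} → (Fin m → Fin n) → Formula F m → Formula F n
rename r (s ≐ t)    = renameTerm r s ≐ renameTerm r t
rename r (finite t) = finite (renameTerm r t)
rename r ⊤̇          = ⊤̇
rename r ⊥̇          = ⊥̇
rename r (¬̇ φ)      = ¬̇ rename r φ
rename r (φ ∧̇ ψ)    = rename r φ ∧̇ rename r ψ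
rename r (φ ∨̇ ψ)    = rename r φ ∨̇ rename r ψ
rename r (φ ⇒̇ ψ)    = rename r φ ⇒̇ rename r ψ
rename r (φ ⇔̇ ψ)    = rename r φ ⇔̇ rename r ψ
rename r (all φ)    = all (rename (under r) φ)
rename r (ex φ)     = ex (rename (under r) φ)

closure : ∀ {ℓ} {F : FunctionSymbols ℓ} n → Formula F n → Proposition F
closure zero    φ = φ
closure (suc n) φ = closure n (all φ)

-- Quantification over a block of k variables.  In a formula over k + n
-- variables, the block consists of the indices i ↑ˡ n, and the remaining
-- variables are the indices k ↑ʳ j.

all^ : ∀ {ℓ} {F : FunctionSymbols ℓ} k {n} → Formula F (k + n) → Formula F n
all^ zero    φ = φ
all^ (suc k) φ = all^ k (all φ)

ex^ : ∀ {ℓ} {F : FunctionSymbols ℓ} k {n} → Formula F (k + n) → Formula F n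
ex^ zero    φ = φ
ex^ (suc k) φ = ex^ k (ex φ)

-- ∃!z̄ φ  is  ∃z̄ φ(z̄) ∧ ∀z̄∀w̄ (φ(z̄) ∧ φ(w̄) → ⋀ᵢ zᵢ = wᵢ).  Under the two
-- blocks the context is k + (k + n): the inner block holds w̄, the outer z̄.
-- toZ and toW send the variables of φ to those of φ(z̄) and φ(w̄).

toZ toW : ∀ k {n} → Fin (k + n) → Fin (k + (k + n))
toZ k     = k ↑ʳ_
toW k {n} = [ (λ i → i ↑ˡ (k + n)) , (λ j → k ↑ʳ (k ↑ʳ j)) ]′ ∘ splitAt k

ex!^ : ∀ {ℓ} {F : FunctionSymbols ℓ} k {n} → Formula F (k + n) → Formula F n
ex!^ k {n} φ =
  ex^ k φ ∧̇
  all^ k (all^ k (rename (toZ k) φ ∧̇ rename (toW k) φ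
                  ⇒̇ ⋀ (λ i → var (toZ k (i ↑ˡ n)) ≐ var (toW k (i ↑ˡ n)))))

-- A vector of possibly non-distinct variables is an arbitrary Vector (Fin n) k.

vars : ∀ {ℓ} {F : FunctionSymbols ℓ} {n k} → Vector (Fin n) k → Vector (Term F n) k
vars xs i = var (xs i)

data T {ℓ} (F : FunctionSymbols ℓ) : Proposition F → Set ℓ where

  clash : ∀ {n} (f g : Symbol F) → f ≢ g →
    (xs : Vector (Fin n) (arity F f)) (ys : Vector (Fin n) (arity F g)) →
    T F (closure n (¬̇ (app f (vars xs) ≐ app g (vars ys))))

  injective : ∀ {n} (f : Symbol F) (xs ys : Vector (Fin n) (arity F f)) →
    T F (closure n (app f (vars xs) ≐ app f (vars ys) ⇒̇ ⋀ (λ i → var (xs i) ≐ var (ys i))))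

  -- zᵢ = tᵢ[x̄z̄], with tᵢ = fs i applied to variables among x̄ and z̄.
  solvable : ∀ {n} (k : ℕ) (fs : Vector (Symbol F) k) →
    (args : ∀ i → Vector (Fin (k + n)) (arity F (fs i))) →
    T F (closure n (ex!^ k (⋀ (λ i → var (i ↑ˡ n) ≐ app (fs i) (vars (args i))))))

  -- u is the variable zero.  A term contains a function symbol exactly when
  -- it is an application.
  acyclic : ∀ {n} (f : Symbol F) (ts : Vector (Term F (suc n)) (arity F f)) →
    zero OccursIn app f ts →
    T F (closure n (all (¬̇ (var zero ≐ app f ts ∧̇ finite (var zero)))))

  -- u is the variable zero, hence the shift of x̄.
  finiteness : ∀ {n} (f : Symbol F) (xs : Vector (Fin n) (arity F f)) →
    T F (closure n (all
      (  var zero ≐ app f (vars (λ i → suc (xs i))) ∧̇ finite (var zero)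
      ⇔̇  var zero ≐ app f (vars (λ i → suc (xs i))) ∧̇ ⋀ (λ i → finite (var (suc (xs i)))))))

-- The domain is a setoid, whose equality interprets the equality symbol;
-- classically such a structure is one with true equality on the quotient.
-- Non-emptiness of the domain is not required: it is automatic as soon as F
-- has a constant.

record Structure {ℓ} (F : FunctionSymbols ℓ) : Set (Level.suc ℓ) where
  field
    domain : Setoid ℓ ℓ

  open Setoid domain public using (Carrier; _≈_)

  field
    fun         : (f : Symbol F) → Vector Carrier (arity F f) → Carrier
    fun-cong    : ∀ f {as bs} → (∀ i → as i ≈ bs i) → fun f as ≈ fun f bs
    Finite      : Carrier → Set ℓ
    Finite-resp : ∀ {a b} → a ≈ b → Finite a → Finite b

module _ {ℓ} {F : FunctionSymbols ℓ} (M : Structure F) where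
  open Structure M

  ⟦_⟧ : ∀ {n} → Term F n → Vector Carrier n → Carrier
  ⟦ var x ⟧    ρ = ρ x
  ⟦ app f ts ⟧ ρ = fun f (λ i → ⟦ ts i ⟧ ρ)

  Satisfies : ∀ {n} → Formula F n → Vector Carrier n → Set ℓ
  Satisfies (s ≐ t)    ρ = ⟦ s ⟧ ρ ≈ ⟦ t ⟧ ρ
  Satisfies (finite t) ρ = Finite (⟦ t ⟧ ρ)
  Satisfies ⊤̇          ρ = ⊤
  Satisfies ⊥̇          ρ = ⊥
  Satisfies (¬̇ φ)      ρ = ¬ Satisfies φ ρ
  Satisfies (φ ∧̇ ψ)    ρ = Satisfies φ ρ × Satisfies ψ ρ
  Satisfies (φ ∨̇ ψ)    ρ = Satisfies φ ρ ⊎ Satisfies ψ ρ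
  Satisfies (φ ⇒̇ ψ)    ρ = Satisfies φ ρ → Satisfies ψ ρ
  Satisfies (φ ⇔̇ ψ)    ρ = (Satisfies φ ρ → Satisfies ψ ρ) × (Satisfies ψ ρ → Satisfies φ ρ)
  Satisfies (all φ)    ρ = ∀ a → Satisfies φ (a ∷ ρ)
  Satisfies (ex φ)     ρ = ∃[ a ] Satisfies φ (a ∷ ρ)

  True : Proposition F → Set ℓ
  True φ = Satisfies φ []

infix 3 _⊨_

_⊨_ : ∀ {ℓ} {F : FunctionSymbols ℓ} → (Proposition F → Set ℓ) → Proposition F → Set (Level.suc ℓ)
_⊨_ {F = F} Ax φ = (M : Structure F) → (∀ ψ → Ax ψ → True M ψ) → True M φ

{-# OPTIONS --safe #-}
module Submission where

-- Any two models M and N of T are compared by a back-and-forth argument, restricted to the finite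
-- set F₀ of symbols of the given formula.  A position is a relation between M and N that respects
-- equality, finiteness and, down to depth D, the decompositions u = f(ū) with f ∈ F₀.  To answer a
-- new element a, unfold a along F₀ to depth d, which reaches a number of elements that is bounded in
-- terms of F₀ and d only.  Those that are already related keep their partners; those that are not
-- applications of a symbol of F₀ to reached elements get partners with new, pairwise distinct root
-- symbols, of which there are enough since F is infinite; axiom 3 yields the partners of all others.
-- Uniqueness in axiom 3 makes this correspondence injective, and axioms 4 and 5 make it respect
-- finiteness, because an infinite descent through finitely many elements contains a cycle.  Hence
-- every proposition has the same truth value in M and in the model of all trees, where excluded
-- middle decides it; that model also shows that T is consistent.

open import Defs
open import Axiom.ExcludedMiddle using (ExcludedMiddle)
import Level
open import Data.Empty.Polymorphic using (⊥)
open import Data.Fin using (Fin; zero; suc; toℕ; fromℕ<; _↑ˡ_; _↑ʳ_; splitAt; combine; remQuot; punchIn; punchOut; _≟_)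
open import Data.Fin.Properties
  using (splitAt-↑ˡ; splitAt-↑ʳ; toℕ<n; fromℕ<-toℕ; remQuot-combine; punchIn-punchOut)
open import Data.List as List using (List; []; _∷_; length; concat; concatMap)
open import Data.List.Membership.Propositional using (_∈_; _∉_)
open import Data.List.Membership.Propositional.Properties using (∈-allFin; ∈-map⁺; ∈-++⁺ˡ; ∈-++⁺ʳ)
open import Data.List.Properties using (length-++; length-tabulate)
import Data.List.Relation.Unary.All as All
open import Data.List.Relation.Unary.Any as Any using (Any; here; there)
import Data.List.Relation.Unary.Any.Properties as Any
open import Data.List.Relation.Binary.Subset.Propositional using (_⊆_)
open import Data.Nat
  using (ℕ; zero; suc; _+_; _*_; _⊔_; _≤_; _<_; _<?_; z≤n; s≤s; _≤′_; ≤′-refl; ≤′-step; NonZero; >-nonZero⁻¹)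
open import Data.Nat.Properties
  using (≤-refl; ≤-reflexive; ≤-trans; <-trans; <⇒≤; n≤1+n; m≤n+m; m≤n⇒m≤1+n; m≤m⊔n; m≤n⊔m; +-mono-≤;
         +-monoˡ-≤; +-monoʳ-≤; *-monoˡ-≤; ≤⇒≤′; ≤-totalOrder; module ≤-Reasoning)
open import Data.List.Extrema ≤-totalOrder using (max; xs≤max)
open import Data.Product using (Σ; ∃; ∃-syntax; _×_; _,_; proj₁; proj₂)
open import Data.Sum as Sum using (_⊎_; inj₁; inj₂; [_,_]′)
open import Data.Unit.Polymorphic using (⊤; tt)
open import Data.Vec.Functional using (Vector; _++_; head; tail; updateAt) renaming ([] to []ᵛ; _∷_ to _∷ᵛ_)
open import Data.Vec.Functional.Properties using (updateAt-updates; updateAt-minimal)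
open import Function using (_∘_; _$_; id; const)
open import Induction.WellFounded using (Acc; acc; acc-inverse; acc⇒asym)
open import Relation.Binary.Bundles using (Setoid)
open import Relation.Binary.Construct.Closure.Transitive using (TransClosure; [_]; _∷_; _∷ʳ_; accessible)
open import Relation.Binary.Core using (Rel)
open import Relation.Binary.Definitions using (Transitive)
open import Relation.Binary.PropositionalEquality as ≡ using (_≡_; _≢_; _≗_)
import Relation.Binary.Reasoning.Setoid as ≈-Reasoning
open import Relation.Nullary using (¬_; yes; no; contradiction)
open import Relation.Nullary.Decidable using (decidable-stable)

open FunctionSymbols

-- Semantics of the axioms

module Semantics {ℓ} {F : FunctionSymbols ℓ} (M : Structure F) where
  open Structure M
  open Setoid domain using (refl; sym; trans; reflexive)

  ⟦⟧-cong : ∀ {n} (t : Term F n) {ρ σ} → (∀ i → ρ i ≈ σ i) → ⟦ M ⟧ t ρ ≈ ⟦ M ⟧ t σ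
  ⟦⟧-cong (var x)    ρ≈σ = ρ≈σ x
  ⟦⟧-cong (app f ts) ρ≈σ = fun-cong f λ i → ⟦⟧-cong (ts i) ρ≈σ

  ∷-cong : ∀ {n} a {ρ σ : Vector Carrier n} → (∀ i → ρ i ≈ σ i) →
           ∀ i → (a ∷ᵛ ρ) i ≈ (a ∷ᵛ σ) i
  ∷-cong a ρ≈σ zero    = refl
  ∷-cong a ρ≈σ (suc i) = ρ≈σ i

  -- Environments are functions, and the different ways of building one agree only pointwise;
  -- satisfaction is moved between them by this lemma.
  Satisfies-cong : ∀ {n} (φ : Formula F n) {ρ σ} → (∀ i → ρ i ≈ σ i) →
                   Satisfies M φ ρ → Satisfies M φ σ
  Satisfies-cong (s ≐ t)    ρ≈σ s≈t =
    trans (sym (⟦⟧-cong s ρ≈σ)) (trans s≈t (⟦⟧-cong t ρ≈σ))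
  Satisfies-cong (finite t) ρ≈σ p = Finite-resp (⟦⟧-cong t ρ≈σ) p
  Satisfies-cong ⊤̇          ρ≈σ p = p
  Satisfies-cong (¬̇ φ)      ρ≈σ p = p ∘ Satisfies-cong φ (sym ∘ ρ≈σ)
  Satisfies-cong (φ ∧̇ ψ)    ρ≈σ (p , q) = Satisfies-cong φ ρ≈σ p , Satisfies-cong ψ ρ≈σ q
  Satisfies-cong (φ ∨̇ ψ)    ρ≈σ = Sum.map (Satisfies-cong φ ρ≈σ) (Satisfies-cong ψ ρ≈σ)
  Satisfies-cong (φ ⇒̇ ψ)    ρ≈σ p = Satisfies-cong ψ ρ≈σ ∘ p ∘ Satisfies-cong φ (sym ∘ ρ≈σ)
  Satisfies-cong (φ ⇔̇ ψ)    ρ≈σ (p , q) =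
    Satisfies-cong ψ ρ≈σ ∘ p ∘ Satisfies-cong φ (sym ∘ ρ≈σ) ,
    Satisfies-cong φ ρ≈σ ∘ q ∘ Satisfies-cong ψ (sym ∘ ρ≈σ)
  Satisfies-cong (all φ)    ρ≈σ p a = Satisfies-cong φ (∷-cong a ρ≈σ) (p a)
  Satisfies-cong (ex φ)     ρ≈σ (a , p) = a , Satisfies-cong φ (∷-cong a ρ≈σ) p

  closure-elim : ∀ n (φ : Formula F n) → True M (closure n φ) → ∀ ρ → Satisfies M φ ρ
  closure-elim zero    φ p ρ = Satisfies-cong φ (λ ()) p
  closure-elim (suc n) φ p ρ =
    Satisfies-cong φ (λ { zero → refl ; (suc i) → refl })
      (closure-elim n (all φ) p (tail ρ) (head ρ))

  closure-intro : ∀ n (φ : Formula F n) → (∀ ρ → Satisfies M φ ρ) → True M (closure n φ)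
  closure-intro zero    φ p = p []ᵛ
  closure-intro (suc n) φ p = closure-intro n (all φ) λ ρ a → p (a ∷ᵛ ρ)

  ∷-++ : ∀ {k n} a (ζ : Vector Carrier k) (ρ : Vector Carrier n) →
         (a ∷ᵛ ζ ++ ρ) ≗ ((a ∷ᵛ ζ) ++ ρ)
  ∷-++ a ζ ρ zero = ≡.refl
  ∷-++ {k} a ζ ρ (suc i) with splitAt k i
  ... | inj₁ _ = ≡.refl
  ... | inj₂ _ = ≡.refl

  head∷tail-++ : ∀ {k n} (ζ : Vector Carrier (suc k)) (ρ : Vector Carrier n) →
                 (head ζ ∷ᵛ tail ζ ++ ρ) ≗ (ζ ++ ρ)
  head∷tail-++ ζ ρ zero = ≡.refl
  head∷tail-++ {k} ζ ρ (suc i) with splitAt k i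
  ... | inj₁ _ = ≡.refl
  ... | inj₂ _ = ≡.refl

  all^-elim : ∀ k {n} (φ : Formula F (k + n)) {ρ} →
              Satisfies M (all^ k φ) ρ → ∀ ζ → Satisfies M φ (ζ ++ ρ)
  all^-elim zero    φ p ζ = p
  all^-elim (suc k) φ {ρ} p ζ =
    Satisfies-cong φ (reflexive ∘ head∷tail-++ ζ ρ) (all^-elim k (all φ) p (tail ζ) (head ζ))

  all^-intro : ∀ k {n} (φ : Formula F (k + n)) {ρ} →
               (∀ ζ → Satisfies M φ (ζ ++ ρ)) → Satisfies M (all^ k φ) ρ
  all^-intro zero    φ p = p []ᵛ
  all^-intro (suc k) φ {ρ} p = all^-intro k (all φ) λ ζ a →
    Satisfies-cong φ (reflexive ∘ ≡.sym ∘ ∷-++ a ζ ρ) (p (a ∷ᵛ ζ))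

  ex^-elim : ∀ k {n} (φ : Formula F (k + n)) {ρ} →
             Satisfies M (ex^ k φ) ρ → ∃[ ζ ] Satisfies M φ (ζ ++ ρ)
  ex^-elim zero    φ p = []ᵛ , p
  ex^-elim (suc k) φ {ρ} p with ζ , a , q ← ex^-elim k (ex φ) p =
    a ∷ᵛ ζ , Satisfies-cong φ (reflexive ∘ ∷-++ a ζ ρ) q

  ex^-intro : ∀ k {n} (φ : Formula F (k + n)) {ρ} ζ →
              Satisfies M φ (ζ ++ ρ) → Satisfies M (ex^ k φ) ρ
  ex^-intro zero    φ ζ p = p
  ex^-intro (suc k) φ {ρ} ζ p = ex^-intro k (ex φ) (tail ζ)
    (head ζ , Satisfies-cong φ (reflexive ∘ ≡.sym ∘ head∷tail-++ ζ ρ) p)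

  ⋀-elim : ∀ {n k} (φs : Vector (Formula F n) k) {ρ} →
           Satisfies M (⋀ φs) ρ → ∀ i → Satisfies M (φs i) ρ
  ⋀-elim φs (p , ps) zero    = p
  ⋀-elim φs (p , ps) (suc i) = ⋀-elim (tail φs) ps i

  ⋀-intro : ∀ {n k} (φs : Vector (Formula F n) k) {ρ} →
            (∀ i → Satisfies M (φs i) ρ) → Satisfies M (⋀ φs) ρ
  ⋀-intro {k = zero}  φs p = tt
  ⋀-intro {k = suc k} φs p = p zero , ⋀-intro (tail φs) (p ∘ suc)

  rename-⋀-elim : ∀ {m n k} (r : Fin m → Fin n) (φs : Vector (Formula F m) k) {ρ} →
                  Satisfies M (rename r (⋀ φs)) ρ → ∀ i → Satisfies M (rename r (φs i)) ρ
  rename-⋀-elim r φs (p , ps) zero    = p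
  rename-⋀-elim r φs (p , ps) (suc i) = rename-⋀-elim r (tail φs) ps i

  rename-⋀-intro : ∀ {m n k} (r : Fin m → Fin n) (φs : Vector (Formula F m) k) {ρ} →
                   (∀ i → Satisfies M (rename r (φs i)) ρ) → Satisfies M (rename r (⋀ φs)) ρ
  rename-⋀-intro {k = zero}  r φs p = tt
  rename-⋀-intro {k = suc k} r φs p = p zero , rename-⋀-intro r (tail φs) (p ∘ suc)

-- The axioms freed from closures and variables. Axiom 3 splits into existence and uniqueness, axiom
-- 5 into its two directions.
record IsModel {ℓ} {F : FunctionSymbols ℓ} (M : Structure F) : Set ℓ where
  open Structure M

  Solves : ∀ {k n} (fs : Vector (Symbol F) k) (args : ∀ i → Vector (Fin (k + n)) (arity F (fs i))) →
           Vector Carrier n → Vector Carrier k → Set ℓ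
  Solves fs args ρ ζ = ∀ i → ζ i ≈ fun (fs i) (λ j → (ζ ++ ρ) (args i j))

  field
    fun-clash       : ∀ {f g} → f ≢ g → ∀ {as bs} → ¬ (fun f as ≈ fun g bs)
    fun-injective   : ∀ {f as bs} → fun f as ≈ fun f bs → ∀ i → as i ≈ bs i
    solution        : ∀ {k n} fs args (ρ : Vector Carrier n) → ∃[ ζ ] Solves {k} fs args ρ ζ
    solution-unique : ∀ {k n} fs args (ρ : Vector Carrier n) {ζ ω} →
                      Solves {k} fs args ρ ζ → Solves fs args ρ ω → ∀ i → ζ i ≈ ω i
    Finite-acyclic  : ∀ {n f} (ts : Vector (Term F (suc n)) (arity F f)) → zero OccursIn app f ts →
                      ∀ {u} (ρ : Vector Carrier n) → u ≈ ⟦ M ⟧ (app f ts) (u ∷ᵛ ρ) → ¬ Finite u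
    Finite-children : ∀ {f as} → Finite (fun f as) → ∀ i → Finite (as i)
    Finite-fun      : ∀ {f as} → (∀ i → Finite (as i)) → Finite (fun f as)

module _ {ℓ} {F : FunctionSymbols ℓ} (M : Structure F) where
  open Structure M
  open Setoid domain using (refl; sym; trans; reflexive)
  open Semantics M

  private
    ++-↑ˡ : ∀ {k n} (ζ : Vector Carrier k) (ρ : Vector Carrier n) i → (ζ ++ ρ) (i ↑ˡ n) ≡ ζ i
    ++-↑ˡ {k} {n} ζ ρ i = ≡.cong [ ζ , ρ ]′ (splitAt-↑ˡ k i n)

    ++-↑ʳ : ∀ {k n} (ζ : Vector Carrier k) (ρ : Vector Carrier n) i → (ζ ++ ρ) (k ↑ʳ i) ≡ ρ i
    ++-↑ʳ {k} {n} ζ ρ i = ≡.cong [ ζ , ρ ]′ (splitAt-↑ʳ k n i)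

    ++-toZ : ∀ {k n} (ω ζ : Vector Carrier k) (ρ : Vector Carrier n) →
             (ω ++ (ζ ++ ρ)) ∘ toZ k ≗ (ζ ++ ρ)
    ++-toZ ω ζ ρ = ++-↑ʳ ω (ζ ++ ρ)

    ++-toW : ∀ {k n} (ω ζ : Vector Carrier k) (ρ : Vector Carrier n) →
             (ω ++ (ζ ++ ρ)) ∘ toW k ≗ (ω ++ ρ)
    ++-toW {k} ω ζ ρ i with splitAt k i
    ... | inj₁ j = ++-↑ˡ ω (ζ ++ ρ) j
    ... | inj₂ j = ≡.trans (++-↑ʳ ω (ζ ++ ρ) (k ↑ʳ j)) (++-↑ʳ ζ ρ j)

    equations : ∀ {k n} (fs : Vector (Symbol F) k) →
                (∀ i → Vector (Fin (k + n)) (arity F (fs i))) → Vector (Formula F (k + n)) k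
    equations {n = n} fs args i = var (i ↑ˡ n) ≐ app (fs i) (vars (args i))

  -- Each scheme is used at its most general instance, with pairwise distinct variables, to which
  -- the environment assigns the given elements.
  model⇒isModel : (∀ ψ → T F ψ → True M ψ) → IsModel M
  model⇒isModel M⊨T = record
    { fun-clash = λ {f} {g} f≢g {as} {bs} eq →
        closure-elim _ _ (M⊨T _ (clash f g f≢g (_↑ˡ arity F g) (arity F f ↑ʳ_))) (as ++ bs)
          (trans (fun-cong f (reflexive ∘ ++-↑ˡ as bs))
            (trans eq (fun-cong g (reflexive ∘ ≡.sym ∘ ++-↑ʳ as bs))))
    ; fun-injective = λ {f} {as} {bs} eq i →
        trans (reflexive (≡.sym (++-↑ˡ as bs i))) $
        trans (⋀-elim _ (closure-elim _ _ (M⊨T _ (injective f (_↑ˡ arity F f) (arity F f ↑ʳ_))) (as ++ bs)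
                 (trans (fun-cong f (reflexive ∘ ++-↑ˡ as bs))
                   (trans eq (fun-cong f (reflexive ∘ ≡.sym ∘ ++-↑ʳ as bs))))) i)
              (reflexive (++-↑ʳ as bs i))
    ; solution = λ {k} {n} fs args ρ →
        let ζ , p = ex^-elim k (⋀ (equations fs args)) (proj₁ (closure-elim _ _ (M⊨T _ (solvable k fs args)) ρ))
        in ζ , λ i → trans (reflexive (≡.sym (++-↑ˡ ζ ρ i))) (⋀-elim (equations fs args) p i)
    ; solution-unique = λ {k} {n} fs args ρ {ζ} {ω} p q i →
        let env = ω ++ (ζ ++ ρ)
            both = all^-elim k _
                     (all^-elim k _ (proj₂ (closure-elim _ _ (M⊨T _ (solvable k fs args)) ρ)) ζ) ω
            at-z = ++-toZ ω ζ ρ ; at-w = ++-toW ω ζ ρ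
            z≈w = ⋀-elim (λ i → var (toZ k (i ↑ˡ n)) ≐ var (toW k (i ↑ˡ n))) (both
              ( rename-⋀-intro (toZ k) (equations fs args) (λ i →
                  trans (reflexive (≡.trans (at-z (i ↑ˡ n)) (++-↑ˡ ζ ρ i)))
                    (trans (p i) (fun-cong (fs i) (λ j → reflexive (≡.sym (at-z (args i j)))))))
              , rename-⋀-intro (toW k) (equations fs args) (λ i →
                  trans (reflexive (≡.trans (at-w (i ↑ˡ n)) (++-↑ˡ ω ρ i)))
                    (trans (q i) (fun-cong (fs i) (λ j → reflexive (≡.sym (at-w (args i j)))))))
              )) i
        in trans (reflexive (≡.sym (≡.trans (at-z (i ↑ˡ n)) (++-↑ˡ ζ ρ i))))
             (trans z≈w (reflexive (≡.trans (at-w (i ↑ˡ n)) (++-↑ˡ ω ρ i))))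
    ; Finite-acyclic = λ {_} {f} ts occ {u} ρ eq fin →
        closure-elim _ _ (M⊨T _ (acyclic f ts occ)) ρ u (eq , fin)
    ; Finite-children = λ {f} {as} fin →
        ⋀-elim (λ i → finite (var (suc i)))
          (proj₂ (proj₁ (closure-elim _ _ (M⊨T _ (finiteness f id)) as (fun f as)) (refl , fin)))
    ; Finite-fun = λ {f} {as} fins →
        proj₂ (proj₂ (closure-elim _ _ (M⊨T _ (finiteness f id)) as (fun f as))
          (refl , ⋀-intro (λ i → finite (var (suc i))) fins))
    }

  isModel⇒model : IsModel M → ∀ ψ → T F ψ → True M ψ
  isModel⇒model isM _ (clash {n} f g f≢g xs ys) =
    closure-intro n (¬̇ (app f (vars xs) ≐ app g (vars ys))) λ ρ → fun-clash f≢g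
    where open IsModel isM
  isModel⇒model isM _ (injective {n} f xs ys) =
    closure-intro n (app f (vars xs) ≐ app f (vars ys) ⇒̇ ⋀ eqs) λ ρ eq →
      ⋀-intro eqs (fun-injective eq)
    where open IsModel isM
          eqs = λ i → var (xs i) ≐ var (ys i)
  isModel⇒model isM _ (solvable {n} k fs args) = closure-intro n (ex!^ k (⋀ eqs)) λ ρ →
    let ζ , ζ-solves = solution fs args ρ in
      ex^-intro k (⋀ eqs) ζ (⋀-intro eqs λ i → trans (reflexive (++-↑ˡ ζ ρ i)) (ζ-solves i))
    , all^-intro k _ λ ζ → all^-intro k _ λ ω → λ (p , q) →
        ⋀-intro (λ i → var (toZ k (i ↑ˡ n)) ≐ var (toW k (i ↑ˡ n))) λ i →
        let at-z = ++-toZ ω ζ ρ ; at-w = ++-toW ω ζ ρ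
            z = λ i → ≡.trans (at-z (i ↑ˡ n)) (++-↑ˡ ζ ρ i)
            w = λ i → ≡.trans (at-w (i ↑ˡ n)) (++-↑ˡ ω ρ i)
        in trans (reflexive (z i)) (trans
             (solution-unique fs args ρ
               (λ i → trans (reflexive (≡.sym (z i))) (trans (rename-⋀-elim (toZ k) eqs p i)
                        (fun-cong (fs i) λ j → reflexive (at-z (args i j)))))
               (λ i → trans (reflexive (≡.sym (w i))) (trans (rename-⋀-elim (toW k) eqs q i)
                        (fun-cong (fs i) λ j → reflexive (at-w (args i j)))))
               i)
             (reflexive (≡.sym (w i))))
    where open IsModel isM
          eqs = equations fs args
  isModel⇒model isM _ (acyclic {n} f ts occ) =
    closure-intro n (all (¬̇ (var zero ≐ app f ts ∧̇ finite (var zero)))) λ ρ u (eq , fin) →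
      Finite-acyclic ts occ ρ eq fin
    where open IsModel isM
  isModel⇒model isM _ (finiteness {n} f xs) =
    closure-intro n (all (root ∧̇ finite (var zero) ⇔̇ root ∧̇ ⋀ fins)) λ ρ u →
        (λ (eq , fin) → eq , ⋀-intro fins (Finite-children (Finite-resp eq fin)))
      , (λ (eq , ps) → eq , Finite-resp (sym eq) (Finite-fun (⋀-elim fins ps)))
    where open IsModel isM
          root = var zero ≐ app f (vars (λ i → suc (xs i)))
          fins = λ i → finite (var (suc (xs i)))

-- The tree model

-- A tree is a labelling of all paths; labels at paths that leave the tree are junk, which _≈_
-- ignores.

module TreeModel {ℓ} (F : FunctionSymbols ℓ) where

  Tree : Set ℓ
  Tree = List ℕ → Symbol F

  root : Tree → Symbol F
  root t = t []

  child : Tree → ℕ → Tree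
  child t i p = t (i ∷ p)

  infix 4 _≈[_]_ _≈_ _◁_ _◁⁺_

  -- Agreement of the parts above depth k. Equality as agreement at all depths can be proved by
  -- induction on k.
  _≈[_]_ : Tree → ℕ → Tree → Set ℓ
  s ≈[ zero ]  t = ⊤
  s ≈[ suc k ] t = root s ≡ root t × (∀ i → i < arity F (root s) → child s i ≈[ k ] child t i)

  _≈_ : Tree → Tree → Set ℓ
  s ≈ t = ∀ k → s ≈[ k ] t

  ≗⇒≈[] : ∀ k {s t} → s ≗ t → s ≈[ k ] t
  ≗⇒≈[] zero    s≗t = tt
  ≗⇒≈[] (suc k) s≗t = s≗t [] , λ i _ → ≗⇒≈[] k (s≗t ∘ (i ∷_))

  ≈[]-sym : ∀ k {s t} → s ≈[ k ] t → t ≈[ k ] s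
  ≈[]-sym zero    _       = tt
  ≈[]-sym (suc k) (e , c) = ≡.sym e , λ i i<a →
    ≈[]-sym k (c i (≡.subst (λ f → i < arity F f) (≡.sym e) i<a))

  ≈[]-trans : ∀ k {s t u} → s ≈[ k ] t → t ≈[ k ] u → s ≈[ k ] u
  ≈[]-trans zero    _       _       = tt
  ≈[]-trans (suc k) (e , c) (f , d) = ≡.trans e f , λ i i<a →
    ≈[]-trans k (c i i<a) (d i (≡.subst (λ f → i < arity F f) e i<a))

  ≗⇒≈ : ∀ {s t} → s ≗ t → s ≈ t
  ≗⇒≈ s≗t k = ≗⇒≈[] k s≗t

  ≈-sym : ∀ {s t} → s ≈ t → t ≈ s
  ≈-sym s≈t k = ≈[]-sym k (s≈t k)

  ≈-trans : ∀ {s t u} → s ≈ t → t ≈ u → s ≈ u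
  ≈-trans s≈t t≈u k = ≈[]-trans k (s≈t k) (t≈u k)

  node : (f : Symbol F) → Vector Tree (arity F f) → Tree
  node f ts []      = f
  node f ts (i ∷ p) with i <? arity F f
  ... | yes i<a = ts (fromℕ< i<a) p
  ... | no  _   = f

  child-node : ∀ f ts {i} (i<a : i < arity F f) → child (node f ts) i ≗ ts (fromℕ< i<a)
  child-node f ts {i} i<a p with i <? arity F f
  ... | yes _   = ≡.refl
  ... | no  i≮a = contradiction i<a i≮a

  child-node-toℕ : ∀ f ts j → child (node f ts) (toℕ j) ≗ ts j
  child-node-toℕ f ts j p =
    ≡.trans (child-node f ts (toℕ<n j) p) (≡.cong (λ i → ts i p) (fromℕ<-toℕ j _))

  node-cong[] : ∀ k f {ss ts} → (∀ j → ss j ≈[ k ] ts j) → node f ss ≈[ suc k ] node f ts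
  node-cong[] k f {ss} {ts} ss≈ts = ≡.refl , λ i i<a →
    ≈[]-trans k (≗⇒≈[] k (child-node f ss i<a))
      (≈[]-trans k (ss≈ts (fromℕ< i<a)) (≗⇒≈[] k (≡.sym ∘ child-node f ts i<a)))

  node-cong : ∀ f {ss ts} → (∀ j → ss j ≈ ts j) → node f ss ≈ node f ts
  node-cong f ss≈ts zero    = tt
  node-cong f ss≈ts (suc k) = node-cong[] k f λ j → ss≈ts j k

  node-injective : ∀ f {ss ts} → node f ss ≈ node f ts → ∀ j → ss j ≈ ts j
  node-injective f {ss} {ts} eq j = ≈-trans (≗⇒≈ (≡.sym ∘ child-node-toℕ f ss j))
    (≈-trans (λ k → proj₂ (eq (suc k)) (toℕ j) (toℕ<n j)) (≗⇒≈ (child-node-toℕ f ts j)))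

  _◁_ : Tree → Tree → Set ℓ
  s ◁ t = ∃[ i ] i < arity F (root t) × s ≈ child t i

  _◁⁺_ : Tree → Tree → Set ℓ
  _◁⁺_ = TransClosure _◁_

  ◁-respʳ : ∀ {s t u} → t ≈ u → s ◁ t → s ◁ u
  ◁-respʳ t≈u (i , i<a , eq) =
    i , ≡.subst (λ f → i < arity F f) (proj₁ (t≈u 1)) i<a ,
    ≈-trans eq (λ k → proj₂ (t≈u (suc k)) i i<a)

  ◁⁺-respʳ : ∀ {s t u} → t ≈ u → s ◁⁺ t → s ◁⁺ u
  ◁⁺-respʳ t≈u [ s◁t ]     = [ ◁-respʳ t≈u s◁t ]
  ◁⁺-respʳ t≈u (s◁r ∷ r◁t) = s◁r ∷ ◁⁺-respʳ t≈u r◁t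

  argument◁node : ∀ f ts j → ts j ◁ node f ts
  argument◁node f ts j = toℕ j , toℕ<n j , ≗⇒≈ (≡.sym ∘ child-node-toℕ f ts j)

  -- Nodes have finitely many children, so by König's lemma a tree without infinite branches is
  -- finite.
  FiniteTree : Tree → Set ℓ
  FiniteTree = Acc _◁_

  FiniteTree-resp : ∀ {s t} → s ≈ t → FiniteTree s → FiniteTree t
  FiniteTree-resp s≈t (acc rs) = acc λ r◁t → rs (◁-respʳ (≈-sym s≈t) r◁t)

  trees : Structure F
  trees = record
    { domain      = record
      { Carrier = Tree ; _≈_ = _≈_
      ; isEquivalence = record { refl = ≗⇒≈ λ _ → ≡.refl ; sym = ≈-sym ; trans = ≈-trans } }
    ; fun         = node
    ; fun-cong    = node-cong
    ; Finite      = FiniteTree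
    ; Finite-resp = FiniteTree-resp
    }

  occurs⇒◁⁺ : ∀ {n f} {x : Fin n} (ts : Vector (Term F n) (arity F f)) ρ i → x OccursIn ts i →
              ρ x ◁⁺ ⟦ trees ⟧ (app f ts) ρ
  occurs⇒◁⁺ {f = f} ts ρ i occ with argument◁node f (λ i → ⟦ trees ⟧ (ts i) ρ) i
  ... | arg with ts i | occ
  ...   | var x    | here        = [ arg ]
  ...   | app g us | there j occ = occurs⇒◁⁺ us ρ j occ ∷ʳ arg

  -- Every right-hand side shows its root symbol, so each step along a path consumes one equation,
  -- and recursion on the path reads off all labels.
  solutionTree : ∀ {k n} (fs : Vector (Symbol F) k) →
                 (∀ i → Vector (Fin (k + n)) (arity F (fs i))) → Vector Tree n → Vector Tree k
  solutionTree fs args ρ i [] = fs i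
  solutionTree {k} fs args ρ i (j ∷ p) with j <? arity F (fs i)
  ... | yes j<a = [ (λ i′ → solutionTree fs args ρ i′ p) , (λ x → ρ x p) ]′
                    (splitAt k (args i (fromℕ< j<a)))
  ... | no  _   = fs i

  trees-isModel : IsModel trees
  trees-isModel = record
    { fun-clash       = λ f≢g eq → f≢g (proj₁ (eq 1))
    ; fun-injective   = node-injective _
    ; solution        = λ fs args ρ → solutionTree fs args ρ , λ i → ≗⇒≈ (solves fs args ρ i)
    ; solution-unique = λ fs args ρ p q i k → unique fs args ρ p q k i
    -- Such a `u` would be a proper subtree of itself, which accessibility excludes.
    ; Finite-acyclic  = λ { ts (there i occ) ρ eq fin →
        let u◁⁺u = ◁⁺-respʳ (≈-sym eq) (occurs⇒◁⁺ ts _ i occ)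
        in acc⇒asym (accessible _ fin) u◁⁺u u◁⁺u }
    ; Finite-children = λ fin i → acc-inverse fin (argument◁node _ _ i)
    ; Finite-fun      = λ {f} {ts} fins → acc λ (i , i<a , eq) →
        FiniteTree-resp (≈-sym (≈-trans eq (≗⇒≈ (child-node f ts i<a)))) (fins (fromℕ< i<a))
    }
    where
    solves : ∀ {k n} (fs : Vector (Symbol F) k) (args : ∀ i → Vector (Fin (k + n)) (arity F (fs i)))
             (ρ : Vector Tree n) (i : Fin k) →
             solutionTree fs args ρ i ≗ node (fs i) (λ j → (solutionTree fs args ρ ++ ρ) (args i j))
    solves fs args ρ i [] = ≡.refl
    solves {k} fs args ρ i (j ∷ p) with j <? arity F (fs i)
    ... | no  _   = ≡.refl
    ... | yes j<a with splitAt k (args i (fromℕ< j<a))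
    ...   | inj₁ _ = ≡.refl
    ...   | inj₂ _ = ≡.refl

    -- Induction on depth: the equations give both solutions the same root symbols, so agreement of
    -- all unknowns to depth d yields agreement to depth d + 1.
    unique : ∀ {k n} (fs : Vector (Symbol F) k) (args : ∀ i → Vector (Fin (k + n)) (arity F (fs i)))
             (ρ : Vector Tree n) {ζ ω : Vector Tree k} →
             (∀ i → ζ i ≈ node (fs i) (λ j → (ζ ++ ρ) (args i j))) →
             (∀ i → ω i ≈ node (fs i) (λ j → (ω ++ ρ) (args i j))) →
             ∀ d i → ζ i ≈[ d ] ω i
    unique fs args ρ p q zero    i = tt
    unique {k} fs args ρ {ζ} {ω} p q (suc d) i =
      ≈[]-trans (suc d) {ζ i} {node (fs i) ζs} {ω i} (p i (suc d))
        (≈[]-trans (suc d) {node (fs i) ζs} {node (fs i) ωs} {ω i}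
          (node-cong[] d (fs i) agree) (≈-sym (q i) (suc d)))
      where
      ζs = λ j → (ζ ++ ρ) (args i j)
      ωs = λ j → (ω ++ ρ) (args i j)

      agree : ∀ j → ζs j ≈[ d ] ωs j
      agree j with splitAt k (args i j)
      ... | inj₁ i′ = unique fs args ρ p q d i′
      ... | inj₂ _  = ≗⇒≈[] d λ _ → ≡.refl

-- Finite systems of equations

substitute : ∀ {ℓ} {F : FunctionSymbols ℓ} {m n} → (Fin m → Term F n) → Term F m → Term F n
substitute s (var x)    = s x
substitute s (app f ts) = app f (substitute s ∘ ts)

OccursIn-substitute : ∀ {ℓ} {F : FunctionSymbols ℓ} {m n} (s : Fin m → Term F n) {x y} {t : Term F m} →
                      x OccursIn t → y OccursIn s x → y OccursIn substitute s t
OccursIn-substitute s here        y∈ = y∈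
OccursIn-substitute s (there i p) y∈ = there i (OccursIn-substitute s p y∈)

module _ {ℓ} {F : FunctionSymbols ℓ} (M : Structure F) where
  open Structure M

  ⟦substitute⟧ : ∀ {m n} (s : Fin m → Term F n) (t : Term F m) {ρ σ} →
                 (∀ i → ⟦ M ⟧ (s i) ρ ≈ σ i) → ⟦ M ⟧ (substitute s t) ρ ≈ ⟦ M ⟧ t σ
  ⟦substitute⟧ s (var x)    eq = eq x
  ⟦substitute⟧ s (app f ts) eq = fun-cong f λ i → ⟦substitute⟧ s (ts i) eq

-- Finite combinatorics under excluded middle, and its use in models

module Classical {ℓ} (em : ExcludedMiddle ℓ) where

  -- Induction on the list of candidates. If x is not on a cycle, it can be deleted: a step into x
  -- is prolonged by the next step out of it, and transitivity merges the two.
  serial⇒cycle : ∀ {n} {_⊐_ : Rel (Fin n) ℓ} → Transitive _⊐_ → (xs : List (Fin n)) →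
                 (Q : Fin n → Set ℓ) → (∀ {v} → Q v → v ∈ xs) → (∀ {v} → Q v → ∃[ u ] Q u × v ⊐ u) →
                 ∀ {v} → Q v → ∃[ u ] Q u × u ⊐ u
  serial⇒cycle tr [] Q Q⊆xs next q with () ← Q⊆xs q
  serial⇒cycle {n} {_⊐_} tr (x ∷ xs) Q Q⊆xs next q with em {Q x × x ⊐ x}
  ... | yes (qx , x⊐x) = x , qx , x⊐x
  ... | no ¬cycle =
    let u , (qu , _) , u⊐u = serial⇒cycle tr xs Q′ Q′⊆xs next′ (proj₁ (proj₂ (skip q)))
    in u , qu , u⊐u
    where
    Q′ : Fin n → Set ℓ
    Q′ v = Q v × v ≢ x

    Q′⊆xs : ∀ {v} → Q′ v → v ∈ xs
    Q′⊆xs (q , v≢x) with Q⊆xs q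
    ... | here v≡x = contradiction v≡x v≢x
    ... | there p  = p

    skip : ∀ {v} → Q v → ∃[ u ] Q′ u × v ⊐ u
    skip q with next q
    ... | u , qu , v⊐u with u ≟ x
    ...   | no u≢x = u , (qu , u≢x) , v⊐u
    ...   | yes ≡.refl with next qu
    ...     | w , qw , x⊐w with w ≟ x
    ...       | yes ≡.refl = contradiction (qu , x⊐w) ¬cycle
    ...       | no w≢x     = w , (qw , w≢x) , tr v⊐u x⊐w

    next′ : ∀ {v} → Q′ v → ∃[ u ] Q′ u × v ⊐ u
    next′ (q , _) = skip q

  Increasing : ∀ {m} → (ℕ → Fin m → Set ℓ) → Set ℓ
  Increasing P = ∀ {j v} → P j v → P (suc j) v

  -- A chain of subsets of an m-element set cannot grow at each of its first m + 1 steps. If the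
  -- first step adds v, then v stays in the chain, and deleting it leaves a chain on m - 1 elements
  -- that starts one step later.
  stabilizes : ∀ {m} (P : ℕ → Fin m → Set ℓ) → Increasing P →
               ∃[ j ] j ≤ m × (∀ {v} → P (suc j) v → P j v)
  stabilizes {zero}  P inc = 0 , z≤n , λ { {()} }
  stabilizes {suc m} P inc with em {∃[ v ] P 1 v × ¬ P 0 v}
  ... | no stable = 0 , z≤n , λ p₁ → decidable-stable em λ ¬p₀ → stable (_ , p₁ , ¬p₀)
  ... | yes (v , p₁ , _)
    with j , j≤m , stable ← stabilizes {m} (λ j u → P (suc j) (punchIn v u)) inc =
    suc j , s≤s j≤m , λ {u} → stable′ u
    where
    from-1 : ∀ j → P (suc j) v
    from-1 zero    = p₁
    from-1 (suc j) = inc (from-1 j)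

    stable′ : ∀ u → P (suc (suc j)) u → P (suc j) u
    stable′ u p with v ≟ u
    ... | yes ≡.refl = from-1 j
    ... | no v≢u = ≡.subst (P (suc j)) (punchIn-punchOut v≢u)
                     (stable (≡.subst (P (suc (suc j))) (≡.sym (punchIn-punchOut v≢u)) p))

  module _ (A : Setoid ℓ ℓ) where
    open Setoid A

    enumerate : (xs : List Carrier) →
                ∃[ m ] m ≤ length xs × Σ (Vector Carrier m) λ x →
                  (∀ u v → x u ≈ x v → u ≡ v) × (∀ {a} → Any (a ≈_) xs → ∃[ v ] a ≈ x v)
    enumerate [] = 0 , z≤n , []ᵛ , (λ ()) , λ ()
    enumerate (a ∷ xs) with m , m≤n , x , x-inj , covers ← enumerate xs with em {∃[ v ] a ≈ x v}
    ... | yes (v , a≈xv) = m , m≤n⇒m≤1+n m≤n , x , x-inj , λ where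
            (here b≈a) → v , trans b≈a a≈xv
            (there p)  → covers p
    ... | no new = suc m , s≤s m≤n , a ∷ᵛ x , inj , λ where
            (here b≈a) → zero , b≈a
            (there p)  → let v , eq = covers p in suc v , eq
      where
      inj : ∀ u v → (a ∷ᵛ x) u ≈ (a ∷ᵛ x) v → u ≡ v
      inj zero    zero    _  = ≡.refl
      inj zero    (suc v) eq = contradiction (v , eq) new
      inj (suc u) zero    eq = contradiction (u , sym eq) new
      inj (suc u) (suc v) eq = ≡.cong suc (x-inj u v eq)

  module _ (F : FunctionSymbols ℓ) where

    freshSymbol : InfinitelyManyNonConstants F → (fs : List (Symbol F)) →
                  ∃[ f ] NonZero (arity F f) × f ∉ fs
    freshSymbol infinite fs with em {∃[ f ] NonZero (arity F f) × f ∉ fs}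
    ... | yes p = p
    ... | no ¬p = contradiction
      (fs , λ f nz → decidable-stable em λ f∉fs → ¬p (f , nz , f∉fs)) infinite

    freshSymbols : InfinitelyManyNonConstants F → (fs : List (Symbol F)) → ∀ m →
                   Σ (Vector (Symbol F) m) λ g →
                     (∀ v → NonZero (arity F (g v)) × g v ∉ fs) × (∀ u v → g u ≡ g v → u ≡ v)
    freshSymbols infinite fs zero = []ᵛ , (λ ()) , λ ()
    freshSymbols infinite fs (suc m) with f , nz , f∉fs ← freshSymbol infinite fs
      with g , fresh , g-inj ← freshSymbols infinite (f ∷ fs) m =
      f ∷ᵛ g
      , (λ { zero → nz , f∉fs ; (suc v) → proj₁ (fresh v) , proj₂ (fresh v) ∘ there })
      , inj
      where
      inj : ∀ u v → (f ∷ᵛ g) u ≡ (f ∷ᵛ g) v → u ≡ v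
      inj zero    zero    _  = ≡.refl
      inj zero    (suc v) eq = contradiction (here (≡.sym eq)) (proj₂ (fresh v))
      inj (suc u) zero    eq = contradiction (here eq) (proj₂ (fresh u))
      inj (suc u) (suc v) eq = ≡.cong suc (g-inj u v eq)

  module _ (F : FunctionSymbols ℓ) where

    maxArity : List (Symbol F) → ℕ
    maxArity = max 0 ∘ List.map (arity F)

    arity≤maxArity : ∀ {fs f} → f ∈ fs → arity F f ≤ maxArity fs
    arity≤maxArity f∈fs = All.lookup (xs≤max 0 _) (∈-map⁺ (arity F) f∈fs)

    -- Independent of model and element, so that the depth a formula requires is known before any
    -- model is given.
    descendantsBound : List (Symbol F) → ℕ → ℕ
    descendantsBound F₀ zero    = 1
    descendantsBound F₀ (suc j) = descendantsBound F₀ j + descendantsBound F₀ j * maxArity F₀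

  -- Consequences of the axioms in a single model

  module Model {F : FunctionSymbols ℓ} (hasConstant : HasConstant F)
               (M : Structure F) (isModel : IsModel M) where
    open Structure M
    open Setoid domain using (refl; sym; trans; reflexive)
    open IsModel isModel

    symbols-agree : ∀ {f g as bs} → fun f as ≈ fun g bs → f ≡ g
    symbols-agree eq = decidable-stable em λ f≢g → fun-clash f≢g eq

    private
      c = proj₁ hasConstant

      noArgument : ∀ {a} {A : Set a} → Fin (arity F c) → A
      noArgument j with () ← ≡.subst Fin (proj₂ hasConstant) j

    constant : Carrier
    constant = fun c noArgument

    constant-finite : Finite constant
    constant-finite = Finite-fun λ j → noArgument j

    RHS : ℕ → Set ℓ
    RHS m = Carrier ⊎ (∃[ f ] Vector (Fin m) (arity F f))

    _⊢_≐ʳ_ : ∀ {m} → Vector Carrier m → Carrier → RHS m → Set ℓ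
    x ⊢ a ≐ʳ inj₁ b        = a ≈ b
    x ⊢ a ≐ʳ inj₂ (f , ch) = a ≈ fun f (x ∘ ch)

    -- Axiom 3 only allows right-hand sides that are applications, so the given elements become
    -- parameters, and their unknowns get the dummy equation z = constant.
    module System {m} (rhs : Fin m → RHS m) where

      symbol : RHS m → Symbol F
      symbol (inj₁ _)       = c
      symbol (inj₂ (f , _)) = f

      parameter : RHS m → Carrier
      parameter (inj₁ a) = a
      parameter (inj₂ _) = constant

      unknown : RHS m → Carrier → Carrier
      unknown (inj₁ _) _ = constant
      unknown (inj₂ _) a = a

      value : RHS m → Carrier → Carrier
      value (inj₁ a) _ = a
      value (inj₂ _) a = a

      -- A reference to a given element must name its parameter, since its unknown only carries the
      -- dummy value.
      index : RHS m → Fin m → Fin (m + m)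
      index (inj₁ _) v = m ↑ʳ v
      index (inj₂ _) v = v ↑ˡ m

      arguments : ∀ r → Vector (Fin (m + m)) (arity F (symbol r))
      arguments (inj₁ _)          = noArgument
      arguments (inj₂ (f , ch)) j = index (rhs (ch j)) (ch j)

      lookup-index : ∀ (ζ : Vector Carrier m) v →
                     (ζ ++ (parameter ∘ rhs)) (index (rhs v) v) ≡ value (rhs v) (ζ v)
      lookup-index ζ v with rhs v in eq
      ... | inj₁ a = ≡.trans (≡.cong [ ζ , parameter ∘ rhs ]′ (splitAt-↑ʳ m m v)) (≡.cong parameter eq)
      ... | inj₂ _ = ≡.cong [ ζ , parameter ∘ rhs ]′ (splitAt-↑ˡ m v m)

      Solves-rhs : Vector Carrier m → Set ℓ
      Solves-rhs x = ∀ v → x ⊢ x v ≐ʳ rhs v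

      solve : ∃[ x ] Solves-rhs x
      solve with ζ , p ← solution (symbol ∘ rhs) (arguments ∘ rhs) (parameter ∘ rhs) =
        (λ v → value (rhs v) (ζ v)) , λ v → solves v (rhs v) (p v)
        where
        solves : ∀ v r → ζ v ≈ fun (symbol r) (λ j → (ζ ++ (parameter ∘ rhs)) (arguments r j)) →
                 (λ v → value (rhs v) (ζ v)) ⊢ value r (ζ v) ≐ʳ r
        solves v (inj₁ _)        eq = refl
        solves v (inj₂ (f , ch)) eq = trans eq (fun-cong f λ j → reflexive (lookup-index ζ (ch j)))

      -- Resetting the given elements to `constant` turns both solutions into solutions in the form
      -- of axiom 3. Uniqueness there settles the applications; the given elements agree by their
      -- own equations.
      unique : ∀ {x y} → Solves-rhs x → Solves-rhs y → ∀ v → x v ≈ y v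
      unique {x} {y} p q v = agree (rhs v) (p v) (q v)
        (solution-unique (symbol ∘ rhs) (arguments ∘ rhs) (parameter ∘ rhs) (to-unknowns p) (to-unknowns q) v)
        where
        value-unknown : ∀ {x} r a → x ⊢ a ≐ʳ r → value r (unknown r a) ≈ a
        value-unknown (inj₁ _) a eq = sym eq
        value-unknown (inj₂ _) a eq = refl

        agree : ∀ {x y} r {a b} → x ⊢ a ≐ʳ r → y ⊢ b ≐ʳ r → unknown r a ≈ unknown r b → a ≈ b
        agree (inj₁ _) a≈ b≈ _   = trans a≈ (sym b≈)
        agree (inj₂ _) _  _  a≈b = a≈b

        to-unknowns : ∀ {x} → Solves-rhs x →
                      Solves (symbol ∘ rhs) (arguments ∘ rhs) (parameter ∘ rhs) (λ v → unknown (rhs v) (x v))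
        to-unknowns {x} p v = solves (rhs v) (p v)
          where
          ζ : Vector Carrier m
          ζ v = unknown (rhs v) (x v)

          solves : ∀ r {a} → x ⊢ a ≐ʳ r →
                   unknown r a ≈ fun (symbol r) (λ j → (ζ ++ (parameter ∘ rhs)) (arguments r j))
          solves (inj₁ _) _ = fun-cong c λ j → noArgument j
          solves (inj₂ (f , ch)) eq = trans eq (fun-cong f λ j → sym (trans
            (reflexive (lookup-index ζ (ch j)))
            (value-unknown (rhs (ch j)) (x (ch j)) (p (ch j)))))

    -- Nodes where x and y already agree become given elements and the others keep their common
    -- equation, so x and y solve the same system.
    coinduction : ∀ {m} {x y : Vector Carrier m} →
      (∀ v → x v ≈ y v ⊎ ∃[ f ] ∃[ ch ] x v ≈ fun f (x ∘ ch) × y v ≈ fun f (y ∘ ch)) →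
      ∀ v → x v ≈ y v
    coinduction {m} {x} {y} step =
      System.unique (λ v → rhs (step v)) (λ v → x-solves (step v)) (λ v → y-solves (step v))
      where
      Step : Fin m → Set ℓ
      Step v = x v ≈ y v ⊎ ∃[ f ] ∃[ ch ] x v ≈ fun f (x ∘ ch) × y v ≈ fun f (y ∘ ch)

      rhs : ∀ {v} → Step v → RHS m
      rhs {v} (inj₁ _)            = inj₁ (x v)
      rhs     (inj₂ (f , ch , _)) = inj₂ (f , ch)

      x-solves : ∀ {v} (s : Step v) → x ⊢ x v ≐ʳ rhs s
      x-solves (inj₁ _)                = refl
      x-solves (inj₂ (f , ch , eq , _)) = eq

      y-solves : ∀ {v} (s : Step v) → y ⊢ y v ≐ʳ rhs s
      y-solves (inj₁ eq)               = sym eq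
      y-solves (inj₂ (f , ch , _ , eq)) = eq

    -- `coinduction` with pairs of nodes as unknowns, encoded in a single `Fin`: on related pairs
    -- the two components satisfy the same equations.
    bisimilar⇒≈ : ∀ {m n} (x : Vector Carrier m) (y : Vector Carrier n) (R : Fin m → Fin n → Set ℓ) →
      (∀ {v u} → R v u → x v ≈ y u ⊎
        ∃[ f ] ∃[ ch ] ∃[ ch′ ] (∀ k → R (ch k) (ch′ k)) × x v ≈ fun f (x ∘ ch) × y u ≈ fun f (y ∘ ch′)) →
      ∀ {v u} → R v u → x v ≈ y u
    bisimilar⇒≈ {m} {n} x y R step {v} {u} r = begin
      x v                                        ≡⟨ ≡.cong X (remQuot-combine v u) ⟨
      X (remQuot n (combine v u))                ≈⟨ coinduction {x = X ∘ remQuot n} {y = Y ∘ remQuot n}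
                                                      (λ p → step′ (remQuot n p)) (combine v u) ⟩
      Y (remQuot n (combine v u))                ≡⟨ ≡.cong Y (remQuot-combine v u) ⟩
      Y (v , u)                                  ≈⟨ Y-related (v , u) r ⟩
      y u                                        ∎
      where
      open ≈-Reasoning domain

      X Y : Fin m × Fin n → Carrier
      X (v , _) = x v
      Y (v , u) with em {R v u}
      ... | yes _ = y u
      -- With this default `X` and `Y` agree trivially at unrelated pairs.
      ... | no  _ = x v

      Y-related : ∀ p → R (proj₁ p) (proj₂ p) → Y p ≈ y (proj₂ p)
      Y-related (v , u) r with em {R v u}
      ... | yes _ = refl
      ... | no ¬r = contradiction r ¬r

      decoded : ∀ (Z : Fin m × Fin n → Carrier) v u → Z (remQuot n (combine v u)) ≈ Z (v , u)
      decoded Z v u = reflexive (≡.cong Z (remQuot-combine v u))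

      step′ : ∀ p → X p ≈ Y p ⊎
              ∃[ f ] ∃[ ch ] X p ≈ fun f (X ∘ remQuot n ∘ ch) × Y p ≈ fun f (Y ∘ remQuot n ∘ ch)
      step′ (v , u) with em {R v u}
      ... | no _  = inj₁ refl
      ... | yes r with step r
      ...   | inj₁ eq = inj₁ eq
      ...   | inj₂ (f , ch , ch′ , rs , x≈ , y≈) = inj₂
        ( f , (λ k → combine (ch k) (ch′ k))
        , trans x≈ (fun-cong f λ k → sym (decoded X (ch k) (ch′ k)))
        , trans y≈ (fun-cong f λ k → sym (trans (decoded Y (ch k) (ch′ k)) (Y-related _ (rs k)))) )

    -- The situation of axiom 4: variable zero marks u, and the other variables are parameters with
    -- values in x. A loop at v therefore makes `x v` infinite. Substituting for the marked variable
    -- gives transitivity.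
    _⊢_⊐_ : ∀ {m} → Vector Carrier m → Rel (Fin m) ℓ
    x ⊢ v ⊐ u = ∃[ f ] ∃[ ts ] (zero OccursIn app f ts) × x v ≈ ⟦ M ⟧ (app f ts) (x u ∷ᵛ x)

    ⊐-trans : ∀ {m} (x : Vector Carrier m) → Transitive (x ⊢_⊐_)
    ⊐-trans x {v} {u} {w} (f , ts , occ , v≈) (g , us , occ′ , u≈) =
      f , substitute s ∘ ts , OccursIn-substitute s occ occ′ ,
      trans v≈ (sym (⟦substitute⟧ M s (app f ts) λ { zero → sym u≈ ; (suc i) → refl }))
      where s = app g us ∷ᵛ (var ∘ suc)

    child-⊐ : ∀ {m} (x : Vector Carrier m) {v f ch} → x v ≈ fun f (x ∘ ch) → ∀ k → x ⊢ v ⊐ ch k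
    child-⊐ x {v} {f} {ch} eq k =
      f , ts , there {ts = ts} k (≡.subst (zero OccursIn_) (≡.sym (updateAt-updates k args)) here) ,
      trans eq (fun-cong f λ j → reflexive (≡.sym (at j)))
      where
      args = λ j → var (suc (ch j))
      -- Only the k-th argument is written with the marked variable; the others are read as
      -- parameters.
      ts   = updateAt args k (const (var zero))
      at : ∀ j → ⟦ M ⟧ (ts j) (x (ch k) ∷ᵛ x) ≡ x (ch j)
      at j with j ≟ k
      ... | yes ≡.refl rewrite updateAt-updates k {const (var zero)} args = ≡.refl
      ... | no j≢k rewrite updateAt-minimal j k {const (var zero)} args j≢k = ≡.refl

    -- A finite element is f applied to constants. An infinite one solves z = f(z, ..., z), where z
    -- occurs on the right because f is not a constant.
    element-with-root : ∀ {f} → NonZero (arity F f) → (P : Set ℓ) →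
                        ∃[ a ] (∃[ as ] a ≈ fun f as) × (P → Finite a) × (Finite a → P)
    element-with-root {f} nz P with em {P}
    ... | yes p = fun f (const constant) , (_ , refl) , (λ _ → Finite-fun λ _ → constant-finite) , const p
    ... | no ¬p =
      let z , z-solves = System.solve {1} λ _ → inj₂ (f , const zero)
      in z zero , (_ , z-solves zero) , (λ p → contradiction p ¬p) ,
         λ fin → contradiction fin (Finite-acyclic (const (var zero)) occurs []ᵛ (z-solves zero))
      where occurs = there (fromℕ< (>-nonZero⁻¹ _ {{nz}})) here

    -- At most one symbol by axiom 1, and possibly none: the axioms do not force an element to be an
    -- application.
    roots : Carrier → List (Symbol F)
    roots a with em {∃[ f ] ∃[ as ] a ≈ fun f as}
    ... | yes (f , _) = f ∷ []
    ... | no _        = []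

    root∈roots : ∀ {a f as} → a ≈ fun f as → f ∈ roots a
    root∈roots {a} eq with em {∃[ f ] ∃[ as ] a ≈ fun f as}
    ... | yes (g , as , eq′) = here (symbols-agree (trans (sym eq) eq′))
    ... | no ¬root           = contradiction (_ , _ , eq) ¬root

    root∈concatMap-roots : ∀ {a f as bs} → Any (a ≈_) bs → a ≈ fun f as → f ∈ concatMap roots bs
    root∈concatMap-roots a∈bs eq =
      Any.concatMap⁺ roots (Any.map (λ a≈b → root∈roots (trans (sym a≈b) eq)) a∈bs)

    -- Unfolding an element along finitely many symbols

    module _ (F₀ : List (Symbol F)) where

      children : Carrier → List Carrier
      children a with em {∃[ f ] f ∈ F₀ × ∃[ as ] a ≈ fun f as}
      ... | yes (_ , _ , as , _) = List.tabulate as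
      ... | no  _                = []

      child∈children : ∀ {a f as} → f ∈ F₀ → a ≈ fun f as → ∀ i → Any (as i ≈_) (children a)
      child∈children {a} f∈F₀ eq i with em {∃[ f ] f ∈ F₀ × ∃[ as ] a ≈ fun f as}
      ... | no ¬node = contradiction (_ , f∈F₀ , _ , eq) ¬node
      ... | yes (g , _ , bs , eq′) with symbols-agree (trans (sym eq) eq′)
      ...   | ≡.refl = Any.tabulate⁺ i (fun-injective (trans (sym eq) eq′) i)

      length-children : ∀ a → length (children a) ≤ maxArity F F₀
      length-children a with em {∃[ f ] f ∈ F₀ × ∃[ as ] a ≈ fun f as}
      ... | yes (f , f∈F₀ , as , _) = ≤-trans (≤-reflexive (length-tabulate as)) (arity≤maxArity F f∈F₀)
      ... | no  _ = z≤n

      descendants : Carrier → ℕ → List Carrier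
      descendants a zero    = a ∷ []
      descendants a (suc j) = descendants a j List.++ concatMap children (descendants a j)

      length-descendants : ∀ a j → length (descendants a j) ≤ descendantsBound F F₀ j
      length-descendants a zero    = ≤-refl
      length-descendants a (suc j) = begin
        length (as List.++ concatMap children as)            ≡⟨ length-++ as ⟩
        length as + length (concatMap children as)           ≤⟨ +-monoʳ-≤ (length as) (length-concatMap as) ⟩
        length as + length as * maxArity F F₀                ≤⟨ +-mono-≤ ih (*-monoˡ-≤ (maxArity F F₀) ih) ⟩
        descendantsBound F F₀ (suc j)                          ∎
        where
        open ≤-Reasoning
        as = descendants a j
        ih = length-descendants a j

        length-concatMap : ∀ bs → length (concatMap children bs) ≤ length bs * maxArity F F₀
        length-concatMap []       = z≤n
        length-concatMap (b ∷ bs) = ≤-trans (≤-reflexive (length-++ (children b)))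
          (+-mono-≤ (length-children b) (length-concatMap bs))

      -- Equal elements are merged, so this is a graph, possibly with cycles, and not a tree.
      -- `Within j` holds the nodes reached in at most j steps.
      record Unfolding (d : ℕ) (a : Carrier) : Set (Level.suc ℓ) where
        field
          size          : ℕ
          size-bounded  : size ≤ descendantsBound F F₀ d
          at            : Vector Carrier size
          at-injective  : ∀ {u v} → at u ≈ at v → u ≡ v
          Within        : ℕ → Fin size → Set ℓ
          Within-mono   : Increasing Within
          top           : ∃[ v ] Within 0 v × a ≈ at v
          unfold        : ∀ {j v f as} → j < d → Within j v → f ∈ F₀ → at v ≈ fun f as →
                          Σ (Vector (Fin size) (arity F f)) λ ch → ∀ i → Within (suc j) (ch i) × as i ≈ at (ch i)

      unfoldingOf : ∀ d a → Unfolding d a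
      unfoldingOf d a with m , m≤ , x , x-inj , covers ← enumerate domain (descendants a d) = record
        { size         = m
        ; size-bounded = ≤-trans m≤ (length-descendants a d)
        ; at           = x
        ; at-injective = x-inj _ _
        ; Within       = λ j v → Any (x v ≈_) (descendants a j)
        ; Within-mono  = Any.++⁺ˡ
        ; top          =
            let v , a≈xv = covers (at-depth (z≤n {d}) (here refl)) in v , here (sym a≈xv) , a≈xv
        ; unfold       = λ {j} {v} {f} {as} j<d v∈ f∈F₀ eq →
            let as∈ : ∀ i → Any (as i ≈_) (descendants a (suc j))
                as∈ i = Any.++⁺ʳ (descendants a j)
                  (Any.concatMap⁺ children (Any.map (λ xv≈b → child∈children f∈F₀ (trans (sym xv≈b) eq) i) v∈))
                found = λ i → covers (at-depth j<d (as∈ i))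
            in (λ i → proj₁ (found i)) , λ i →
               Any.map (trans (sym (proj₂ (found i)))) (as∈ i) , proj₂ (found i)
        }
        where
        at-depth : ∀ {b i j} → i ≤ j → Any (b ≈_) (descendants a i) → Any (b ≈_) (descendants a j)
        at-depth i≤j p = go (≤⇒≤′ i≤j) p
          where
          go : ∀ {b i j} → i ≤′ j → Any (b ≈_) (descendants a i) → Any (b ≈_) (descendants a j)
          go ≤′-refl       p = p
          go (≤′-step i≤j) p = Any.++⁺ˡ (go i≤j p)

  -- Comparing finiteness in two models

  module _ {F : FunctionSymbols ℓ} (hasConstant : HasConstant F) {M N : Structure F}
           (M-model : IsModel M) (N-model : IsModel N) where
    private
      module M = Structure M
      module N = Structure N
    open Model hasConstant M M-model using (_⊢_⊐_; ⊐-trans; child-⊐)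

    -- Otherwise the nodes at which it fails have infinite descending paths, hence a cycle.
    Finite-preserved : ∀ {m} {x : Vector M.Carrier m} {y : Vector N.Carrier m} →
      (∀ v → (M.Finite (x v) → N.Finite (y v)) ⊎
             ∃[ f ] ∃[ ch ] x v M.≈ M.fun f (x ∘ ch) × y v N.≈ N.fun f (y ∘ ch)) →
      ∀ v → M.Finite (x v) → N.Finite (y v)
    Finite-preserved {m} {x} {y} step v fin = decidable-stable em λ ¬fin →
      let u , (fin-u , _) , f , ts , occ , eq =
            serial⇒cycle (⊐-trans x) (List.allFin m) Mismatch (λ _ → ∈-allFin _) next (fin , ¬fin)
      in IsModel.Finite-acyclic M-model ts occ x eq fin-u
      where
      Mismatch : Fin m → Set ℓ
      Mismatch v = M.Finite (x v) × ¬ N.Finite (y v)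

      next : ∀ {v} → Mismatch v → ∃[ u ] Mismatch u × x ⊢ v ⊐ u
      next {v} (fin , ¬fin) with step v
      ... | inj₁ preserved = contradiction (preserved fin) ¬fin
      ... | inj₂ (f , ch , x≈ , y≈) with em {∃[ k ] ¬ N.Finite (y (ch k))}
      ...   | yes (k , ¬fin-k) =
        ch k , (IsModel.Finite-children M-model (M.Finite-resp x≈ fin) k , ¬fin-k) , child-⊐ x x≈ k
      ...   | no all-finite = contradiction
        (N.Finite-resp (Setoid.sym N.domain y≈) (IsModel.Finite-fun N-model λ k →
          decidable-stable em λ ¬fin-k → all-finite (k , ¬fin-k))) ¬fin

-- Partial isomorphisms and their extension

Stages : ∀ {ℓ} {F : FunctionSymbols ℓ} → Structure F → Structure F → Set (Level.suc ℓ)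
Stages {ℓ} M N = ℕ → Structure.Carrier M → Structure.Carrier N → Set ℓ

module _ {ℓ} {F : FunctionSymbols ℓ} (F₀ : List (Symbol F)) (d : ℕ) where

  -- One direction of a partial isomorphism. `functional` and `preserves` at depth d cover the
  -- smaller depths by `mono`. The finite `range` lets new root symbols avoid those of all related
  -- elements.
  record Simulation (M N : Structure F) (Z : Stages M N) : Set ℓ where
    private
      module M = Structure M
      module N = Structure N
    field
      functional : ∀ {a a′ b b′} → Z d a b → Z d a′ b′ → a M.≈ a′ → b N.≈ b′
      preserves  : ∀ {a b} → Z d a b → M.Finite a → N.Finite b
      forth      : ∀ {j a b f as} → j < d → Z j a b → f ∈ F₀ → a M.≈ M.fun f as →
                   Σ (Vector N.Carrier (arity F f)) λ bs → b N.≈ N.fun f bs × (∀ i → Z (suc j) (as i) (bs i))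
      range      : ∃[ bs ] (∀ {a b} → Z d a b → Any (b N.≈_) bs)

  -- Z 0 relates the elements played so far, Z j their descendants along at most j symbols of F₀.

  record PartialIsomorphism (M N : Structure F) (Z : Stages M N) : Set ℓ where
    private
      module M = Structure M
      module N = Structure N
    field
      mono     : ∀ {j a b} → Z j a b → Z (suc j) a b
      resp     : ∀ {j a a′ b b′} → a M.≈ a′ → b N.≈ b′ → Z j a b → Z j a′ b′
      to       : Simulation M N Z
      from     : Simulation N M (λ j b a → Z j a b)

    mono-≤ : ∀ {i j a b} → i ≤ j → Z i a b → Z j a b
    mono-≤ i≤j = go (≤⇒≤′ i≤j)
      where
      go : ∀ {i j a b} → i ≤′ j → Z i a b → Z j a b
      go ≤′-refl       z = z
      go (≤′-step i≤j) z = mono (go i≤j z)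

inverse : ∀ {ℓ} {F : FunctionSymbols ℓ} {F₀ : List (Symbol F)} {d} {M N : Structure F} {Z : Stages M N} →
          PartialIsomorphism F₀ d M N Z → PartialIsomorphism F₀ d N M (λ j b a → Z j a b)
inverse I = record { mono = mono ; resp = λ b≈ a≈ → resp a≈ b≈ ; to = from ; from = to }
  where open PartialIsomorphism I

module _ {ℓ} (em : ExcludedMiddle ℓ) {F : FunctionSymbols ℓ}
         (infinite : InfinitelyManyNonConstants F) (hasConstant : HasConstant F) where
  open Classical em

  -- Depth d is to be kept, one bound pays for the stabilization of `Old`, the other for that of
  -- `Hit` in `reflect-old`, and the successor for one further decomposition at the stable depth.
  extensionDepth : List (Symbol F) → ℕ → ℕ
  extensionDepth F₀ d = suc (descendantsBound F F₀ d + (descendantsBound F F₀ d + d))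

  module Extension (F₀ : List (Symbol F)) (d : ℕ) {M N : Structure F}
                   (M-model : IsModel M) (N-model : IsModel N)
                   {Z : Stages M N}
                   (I : PartialIsomorphism F₀ (extensionDepth F₀ d) M N Z)
                   (a : Structure.Carrier M) where
    private
      module M where
        open Structure M public
        open Setoid domain public using (refl; sym; trans; reflexive)
        open IsModel M-model public
        open Model hasConstant M M-model public
      module N where
        open Structure N public
        open Setoid domain public using (refl; sym; trans; reflexive)
        open IsModel N-model public
        open Model hasConstant N N-model public

    open PartialIsomorphism I
    open Simulation
    open M.Unfolding (M.unfoldingOf F₀ d a) renaming (at to x; at-injective to x-injective)

    D = extensionDepth F₀ d

    -- Some x v may be related only at depths beyond d.  At depth stage this set has become stable, so
    -- that the children of an old node are old.
    private
      stable = stabilizes (λ j v → ∃[ b ] Z (j + d) (x v) b) λ (b , z) → b , mono z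

    stage : ℕ
    stage = proj₁ stable + d

    Old : Fin size → Set ℓ
    Old v = ∃[ b ] Z stage (x v) b

    Old-stable : ∀ {v b} → Z (suc stage) (x v) b → Old v
    Old-stable z = proj₂ (proj₂ stable) (_ , z)

    d≤stage : d ≤ stage
    d≤stage = m≤n+m d (proj₁ stable)

    stages-bounded : ∀ {i} → i ≤ size → suc (i + stage) ≤ D
    stages-bounded i≤ = s≤s (+-mono-≤ (≤-trans i≤ size-bounded)
      (+-monoˡ-≤ d (≤-trans (proj₁ (proj₂ stable)) size-bounded)))

    stage<D : stage < D
    stage<D = stages-bounded z≤n

    functional′ : ∀ {i j p p′ q q′} → i ≤ D → j ≤ D → Z i p q → Z j p′ q′ → p M.≈ p′ → q N.≈ q′
    functional′ i≤D j≤D z z′ = functional to (mono-≤ i≤D z) (mono-≤ j≤D z′)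

    injective′ : ∀ {i j p p′ q q′} → i ≤ D → j ≤ D → Z i p q → Z j p′ q′ → q N.≈ q′ → p M.≈ p′
    injective′ i≤D j≤D z z′ = functional from (mono-≤ i≤D z) (mono-≤ j≤D z′)

    -- The arguments have to be nodes too. A node on the last level may be an application of a
    -- symbol of `F₀` to elements not reached and still be a leaf; at depth d no decomposition has
    -- to be matched.
    Interior : Fin size → Set ℓ
    Interior v = ∃[ f ] f ∈ F₀ × Σ (Vector (Fin size) (arity F f)) λ ch → x v M.≈ M.fun f (x ∘ ch)

    data Kind (v : Fin size) : Set ℓ where
      old      : Old v → Kind v
      interior : ¬ Old v → Interior v → Kind v
      leaf     : ¬ Old v → ¬ Interior v → Kind v

    kind : ∀ v → Kind v
    kind v with em {Old v}
    ... | yes o = old o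
    ... | no ¬o with em {Interior v}
    ...   | yes i = interior ¬o i
    ...   | no ¬i = leaf ¬o ¬i

    -- Avoiding `F₀` separates the leaves from interior nodes, and avoiding the other roots
    -- separates them from everything related so far.
    reserved : List (Symbol F)
    reserved = F₀ List.++ concatMap N.roots (proj₁ (range to))

    private
      fresh = freshSymbols F infinite reserved size

    leafSymbol : Fin size → Symbol F
    leafSymbol = proj₁ fresh

    leafSymbol-injective : ∀ {u v} → leafSymbol u ≡ leafSymbol v → u ≡ v
    leafSymbol-injective = proj₂ (proj₂ fresh) _ _

    leafSymbol∉F₀ : ∀ {v} → leafSymbol v ∉ F₀
    leafSymbol∉F₀ {v} g∈F₀ = proj₂ (proj₁ (proj₂ fresh) v) (∈-++⁺ˡ g∈F₀)

    leafSymbol-unused : ∀ {j v p q bs} → j ≤ D → Z j p q → ¬ (q N.≈ N.fun (leafSymbol v) bs)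
    leafSymbol-unused {v = v} j≤D z eq = proj₂ (proj₁ (proj₂ fresh) v)
      (∈-++⁺ʳ F₀ (N.root∈concatMap-roots (proj₂ (range to) (mono-≤ j≤D z)) eq))

    leafValue : ∀ v → ∃[ b ] (∃[ bs ] b N.≈ N.fun (leafSymbol v) bs) ×
                      (M.Finite (x v) → N.Finite b) × (N.Finite b → M.Finite (x v))
    leafValue v = N.element-with-root (proj₁ (proj₁ (proj₂ fresh) v)) (M.Finite (x v))

    rhs : ∀ {v} → Kind v → N.RHS size
    rhs     (old (b , _))                 = inj₁ b
    rhs     (interior _ (f , _ , ch , _)) = inj₂ (f , ch)
    rhs {v} (leaf _ _)                    = inj₁ (proj₁ (leafValue v))

    private
      solved = N.System.solve (λ v → rhs (kind v))

    y : Vector N.Carrier size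
    y = proj₁ solved

    data View (v : Fin size) : Set ℓ where
      old      : Z stage (x v) (y v) → View v
      interior : ∀ {f ch} → ¬ Old v → f ∈ F₀ → x v M.≈ M.fun f (x ∘ ch) → y v N.≈ N.fun f (y ∘ ch) → View v
      leaf     : ∀ {bs} → ¬ Old v → ¬ Interior v → y v N.≈ N.fun (leafSymbol v) bs →
                 (M.Finite (x v) → N.Finite (y v)) → (N.Finite (y v) → M.Finite (x v)) → View v

    view : ∀ v → View v
    view v = classify (kind v) (proj₂ solved v)
      where
      classify : (κ : Kind v) → y N.⊢ y v ≐ʳ rhs κ → View v
      classify (old (b , z)) eq = old (resp M.refl (N.sym eq) z)
      classify (interior ¬o (f , f∈F₀ , ch , eqᴹ)) eq = interior ¬o f∈F₀ eqᴹ eq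
      classify (leaf ¬o ¬i) eq =
        let _ , (_ , root) , finite-to , finite-from = leafValue v
        in leaf ¬o ¬i (N.trans eq root) (N.Finite-resp (N.sym eq) ∘ finite-to) (finite-from ∘ N.Finite-resp eq)

    -- Stated one depth beyond `stage`, where `forth` puts the children of an old node; by stability
    -- such a child is old itself.
    y-old : ∀ {v b} → Z (suc stage) (x v) b → y v N.≈ b
    y-old {v} z with view v
    ... | old z′              = functional′ (<⇒≤ stage<D) stage<D z′ z M.refl
    ... | interior ¬o _ _ _   = contradiction (Old-stable z) ¬o
    ... | leaf ¬o _ _ _ _     = contradiction (Old-stable z) ¬o

    -- At an old node `forth` carries the decomposition to N, and `y-old` identifies the arguments.
    -- At an interior node axioms 1 and 2 make it the decomposition already used as equation.
    y-node : ∀ {v f ch} → f ∈ F₀ → x v M.≈ M.fun f (x ∘ ch) → y v N.≈ N.fun f (y ∘ ch)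
    y-node {v} {f} {ch} f∈F₀ eq with view v
    ... | leaf _ ¬i _ _ _ = contradiction (f , f∈F₀ , ch , eq) ¬i
    ... | old z with bs , eqᴺ , zs ← forth to stage<D z f∈F₀ eq =
      N.trans eqᴺ (N.fun-cong f λ i → N.sym (y-old (zs i)))
    ... | interior _ _ eqᴹ eqᴺ with M.symbols-agree (M.trans (M.sym eqᴹ) eq)
    ...   | ≡.refl = N.trans eqᴺ (N.fun-cong f λ i → N.reflexive
      (≡.cong y (x-injective (M.fun-injective (M.trans (M.sym eqᴹ) eq) i))))

    -- The nodes whose value is in the range of Z, taken at a depth where this set has become
    -- stable, and the elements that Z relates to these values are two solutions of one system.
    reflect-old : ∀ {v p} → Z stage p (y v) → x v M.≈ p
    reflect-old {v} {p} z = M.trans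
      (M.bisimilar⇒≈ x preimage (λ v u → Hit v × v ≡ u) step (hit₀ , ≡.refl))
      (injective′ later≤D (<⇒≤ stage<D) (preimage-related hit₀) z N.refl)
      where
      HitAt : ℕ → Fin size → Set ℓ
      HitAt i v = ∃[ p ] Z (i + stage) p (y v)

      stableHit = stabilizes HitAt λ (p , z) → p , mono z
      later     = proj₁ stableHit + stage
      later<D   = stages-bounded (proj₁ (proj₂ stableHit))
      later≤D   = <⇒≤ later<D
      Hit       = HitAt (proj₁ stableHit)

      hit₀ : Hit v
      hit₀ = p , mono-≤ (m≤n+m stage (proj₁ stableHit)) z

      preimage : Vector M.Carrier size
      preimage v with em {Hit v}
      ... | yes (p , _) = p
      ... | no  _       = x v

      preimage-related : ∀ {v} → Hit v → Z later (preimage v) (y v)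
      preimage-related {v} hit with em {Hit v}
      ... | yes (_ , z) = z
      ... | no ¬hit     = contradiction hit ¬hit

      step : ∀ {v u} → Hit v × v ≡ u → x v M.≈ preimage u ⊎
             ∃[ f ] ∃[ ch ] ∃[ ch′ ] (∀ k → Hit (ch k) × ch k ≡ ch′ k) ×
               x v M.≈ M.fun f (x ∘ ch) × preimage u M.≈ M.fun f (preimage ∘ ch′)
      step {v} (hit , ≡.refl) with view v
      ... | old z = inj₁ (injective′ (<⇒≤ stage<D) later≤D z (preimage-related hit) N.refl)
      -- A leaf is never hit, because its root symbol avoids the range.
      ... | leaf _ _ eq _ _ = contradiction eq (leafSymbol-unused later≤D (preimage-related hit))
      -- Decomposing backwards relates the values of the children one depth later, and by stability
      -- the children are hit as well.
      ... | interior {f} {ch} _ f∈F₀ eqᴹ eqᴺ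
        with ps , eq , zs ← forth from later<D (preimage-related hit) f∈F₀ eqᴺ =
        inj₂ (f , ch , ch , (λ k → hits k , ≡.refl) , eqᴹ , M.trans eq (M.fun-cong f λ k →
          injective′ later<D later≤D (zs k) (preimage-related (hits k)) N.refl))
        where
        hits : ∀ k → Hit (ch k)
        hits k = proj₂ (proj₂ stableHit) (_ , zs k)

    -- Having equal values is a bisimulation: old nodes are settled by `reflect-old`, distinct
    -- leaves and mixed pairs differ in their root symbols, and two interior nodes pass the equality
    -- on to their children.
    y-injective : ∀ {v u} → y v N.≈ y u → x v M.≈ x u
    y-injective = M.bisimilar⇒≈ x x (λ v u → y v N.≈ y u) step
      where
      step : ∀ {v u} → y v N.≈ y u → x v M.≈ x u ⊎
             ∃[ f ] ∃[ ch ] ∃[ ch′ ] (∀ k → y (ch k) N.≈ y (ch′ k)) ×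
               x v M.≈ M.fun f (x ∘ ch) × x u M.≈ M.fun f (x ∘ ch′)
      step {v} {u} eq with view v | view u
      ... | old z | _ = inj₁ (M.sym (reflect-old (resp M.refl eq z)))
      ... | _ | old z = inj₁ (reflect-old (resp M.refl (N.sym eq) z))
      ... | leaf _ _ eqv _ _ | leaf _ _ equ _ _
        with leafSymbol-injective {v} {u} (N.symbols-agree (N.trans (N.sym eqv) (N.trans eq equ)))
      ...   | ≡.refl = inj₁ M.refl
      step {v} {u} eq | leaf _ _ eqv _ _ | interior _ f∈F₀ _ equ =
        contradiction (≡.subst (_∈ F₀) (N.symbols-agree (N.trans (N.sym equ) (N.trans (N.sym eq) eqv))) f∈F₀)
          (leafSymbol∉F₀ {v})
      step {v} {u} eq | interior _ f∈F₀ _ eqv | leaf _ _ equ _ _ =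
        contradiction (≡.subst (_∈ F₀) (N.symbols-agree (N.trans (N.sym eqv) (N.trans eq equ))) f∈F₀)
          (leafSymbol∉F₀ {u})
      step {v} {u} eq | interior _ _ eqvᴹ eqvᴺ | interior _ _ equᴹ equᴺ
        with N.symbols-agree (N.trans (N.sym eqvᴺ) (N.trans eq equᴺ))
      ... | ≡.refl = inj₂ (_ , _ , _ , N.fun-injective (N.trans (N.sym eqvᴺ) (N.trans eq equᴺ)) , eqvᴹ , equᴹ)

    Finite-to : ∀ v → M.Finite (x v) → N.Finite (y v)
    Finite-to = Finite-preserved hasConstant M-model N-model λ v → step (view v)
      where
      step : ∀ {v} → View v → _
      step (old z)               = inj₁ (preserves to (mono-≤ (<⇒≤ stage<D) z))
      step (interior _ _ eq eq′) = inj₂ (_ , _ , eq , eq′)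
      step (leaf _ _ _ p _)      = inj₁ p

    Finite-from : ∀ v → N.Finite (y v) → M.Finite (x v)
    Finite-from = Finite-preserved hasConstant N-model M-model λ v → step (view v)
      where
      step : ∀ {v} → View v → _
      step (old z)               = inj₁ (preserves from (mono-≤ (<⇒≤ stage<D) z))
      step (interior _ _ eq eq′) = inj₂ (_ , _ , eq′ , eq)
      step (leaf _ _ _ _ p)      = inj₁ p

    Extended : Stages M N
    Extended j p q = Z j p q ⊎ ∃[ v ] Within j v × p M.≈ x v × q N.≈ y v

    private
      lift : ∀ {j p q} → j ≤ d → Z j p q → Z stage p q
      lift j≤d = mono-≤ (≤-trans j≤d d≤stage)

      d<D : d < D
      d<D = ≤-trans (s≤s d≤stage) stage<D

      extended-functional : ∀ {p p′ q q′} → Extended d p q → Extended d p′ q′ → p M.≈ p′ → q N.≈ q′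
      extended-functional (inj₁ z) (inj₁ z′) eq = functional′ (<⇒≤ d<D) (<⇒≤ d<D) z z′ eq
      -- A related element that is also a node is an old node, since d is at most `stage`.
      extended-functional (inj₁ z) (inj₂ (_ , _ , p≈ , q≈)) eq =
        N.trans (N.sym (y-old (mono (lift ≤-refl (resp (M.trans eq p≈) N.refl z))))) (N.sym q≈)
      extended-functional (inj₂ (_ , _ , p≈ , q≈)) (inj₁ z) eq =
        N.trans q≈ (y-old (mono (lift ≤-refl (resp (M.trans (M.sym eq) p≈) N.refl z))))
      extended-functional (inj₂ (_ , _ , p≈ , q≈)) (inj₂ (_ , _ , p′≈ , q′≈)) eq
        with x-injective (M.trans (M.sym p≈) (M.trans eq p′≈))
      ... | ≡.refl = N.trans q≈ (N.sym q′≈)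

      extended-injective : ∀ {p p′ q q′} → Extended d p q → Extended d p′ q′ → q N.≈ q′ → p M.≈ p′
      extended-injective (inj₁ z) (inj₁ z′) eq = injective′ (<⇒≤ d<D) (<⇒≤ d<D) z z′ eq
      extended-injective (inj₁ z) (inj₂ (_ , _ , p≈ , q≈)) eq =
        M.sym (M.trans p≈ (reflect-old (lift ≤-refl (resp M.refl (N.trans eq q≈) z))))
      extended-injective (inj₂ (_ , _ , p≈ , q≈)) (inj₁ z) eq =
        M.trans p≈ (reflect-old (lift ≤-refl (resp M.refl (N.trans (N.sym eq) q≈) z)))
      extended-injective (inj₂ (_ , _ , p≈ , q≈)) (inj₂ (_ , _ , p′≈ , q′≈)) eq =
        M.trans p≈ (M.trans (y-injective (N.trans (N.sym q≈) (N.trans eq q′≈))) (M.sym p′≈))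

      extended-forth : ∀ {j p q f ps} → j < d → Extended j p q → f ∈ F₀ → p M.≈ M.fun f ps →
                       Σ (Vector N.Carrier (arity F f)) λ qs →
                         q N.≈ N.fun f qs × (∀ i → Extended (suc j) (ps i) (qs i))
      extended-forth j<d (inj₁ z) f∈F₀ eq =
        let qs , eqᴺ , zs = forth to (<-trans j<d d<D) z f∈F₀ eq in qs , eqᴺ , inj₁ ∘ zs
      extended-forth j<d (inj₂ (v , v∈ , p≈ , q≈)) f∈F₀ eq =
        let eqᴹ      = M.trans (M.sym p≈) eq
            ch , chs = unfold j<d v∈ f∈F₀ eqᴹ
        in y ∘ ch
         , N.trans q≈ (y-node f∈F₀ (M.trans eqᴹ (M.fun-cong _ λ i → proj₂ (chs i))))
         , λ i → inj₂ (ch i , proj₁ (chs i) , proj₂ (chs i) , N.refl)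

      -- A node whose value has a root in `F₀` is no leaf, so it has some decomposition in M along
      -- `F₀`. Its image under `y-node` must coincide with the given one by axioms 1 and 2.
      extended-back : ∀ {j p q f qs} → j < d → Extended j p q → f ∈ F₀ → q N.≈ N.fun f qs →
                      Σ (Vector M.Carrier (arity F f)) λ ps →
                        p M.≈ M.fun f ps × (∀ i → Extended (suc j) (ps i) (qs i))
      extended-back j<d (inj₁ z) f∈F₀ eq =
        let ps , eqᴹ , zs = forth from (<-trans j<d d<D) z f∈F₀ eq in ps , eqᴹ , inj₁ ∘ zs
      extended-back {f = f} {qs} j<d (inj₂ (v , v∈ , p≈ , q≈)) f∈F₀ eq =
        let g , g∈F₀ , ps , eqᴹ = application (view v) in along g∈F₀ eqᴹ
        where
        eqᴺ = N.trans (N.sym q≈) eq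

        application : View v → ∃[ g ] g ∈ F₀ × ∃[ ps ] x v M.≈ M.fun g ps
        application (old z)              = let ps , eqᴹ , _ = forth from stage<D z f∈F₀ eqᴺ in f , f∈F₀ , ps , eqᴹ
        application (interior _ g∈ eqᴹ _) = _ , g∈ , _ , eqᴹ
        application (leaf _ _ root _ _)  = contradiction
          (≡.subst (_∈ F₀) (N.symbols-agree (N.trans (N.sym eqᴺ) root)) f∈F₀) (leafSymbol∉F₀ {v})

        along : ∀ {g ps} → g ∈ F₀ → x v M.≈ M.fun g ps → _
        along {g} {ps} g∈F₀ eqᴹ
          with ch , chs ← unfold j<d v∈ g∈F₀ eqᴹ
          with eq′ ← y-node g∈F₀ (M.trans eqᴹ (M.fun-cong g λ i → proj₂ (chs i)))
          with N.symbols-agree (N.trans (N.sym eqᴺ) eq′)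
        ... | ≡.refl = ps , M.trans p≈ eqᴹ , λ i → inj₂
          (ch i , proj₁ (chs i) , proj₂ (chs i) , N.fun-injective (N.trans (N.sym eqᴺ) eq′) i)

      extended-preserves : ∀ {p q} → Extended d p q → M.Finite p → N.Finite q
      extended-preserves (inj₁ z) = preserves to (mono-≤ (<⇒≤ d<D) z)
      extended-preserves (inj₂ (v , _ , p≈ , q≈)) = N.Finite-resp (N.sym q≈) ∘ Finite-to v ∘ M.Finite-resp p≈

      extended-reflects : ∀ {p q} → Extended d p q → N.Finite q → M.Finite p
      extended-reflects (inj₁ z) = preserves from (mono-≤ (<⇒≤ d<D) z)
      extended-reflects (inj₂ (v , _ , p≈ , q≈)) = M.Finite-resp (M.sym p≈) ∘ Finite-from v ∘ N.Finite-resp q≈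

    extension : PartialIsomorphism F₀ d M N Extended
    extension = record
      { mono = λ {j} → λ where
          (inj₁ z)              → inj₁ (mono z)
          (inj₂ (v , v∈ , eqs)) → inj₂ (v , Within-mono {j} v∈ , eqs)
      ; resp = λ { p≈ q≈ (inj₁ z) → inj₁ (resp p≈ q≈ z)
                 ; p≈ q≈ (inj₂ (v , v∈ , eqᴹ , eqᴺ)) →
                     inj₂ (v , v∈ , M.trans (M.sym p≈) eqᴹ , N.trans (N.sym q≈) eqᴺ) }
      ; to   = record
        { functional = extended-functional
        ; preserves  = extended-preserves
        ; forth      = extended-forth
        ; range      = proj₁ (range to) List.++ List.tabulate y , λ where
            (inj₁ z)                → Any.++⁺ˡ (proj₂ (range to) (mono-≤ (<⇒≤ d<D) z))
            (inj₂ (v , _ , _ , q≈)) → Any.++⁺ʳ (proj₁ (range to)) (Any.tabulate⁺ v q≈)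
        }
      ; from = record
        { functional = extended-injective
        ; preserves  = extended-reflects
        ; forth      = extended-back
        ; range      = proj₁ (range from) List.++ List.tabulate x , λ where
            (inj₁ z)                → Any.++⁺ˡ (proj₂ (range from) (mono-≤ (<⇒≤ d<D) z))
            (inj₂ (v , _ , p≈ , _)) → Any.++⁺ʳ (proj₁ (range from)) (Any.tabulate⁺ v p≈)
        }
      }

    extended-at-a : ∃[ b ] Extended 0 a b
    extended-at-a = let v , v∈ , a≈ = top in y v , inj₂ (v , v∈ , a≈ , N.refl)

-- Transfer of formulas

module _ {ℓ} {F : FunctionSymbols ℓ} where

  symbolsᵗ : ∀ {n} → Term F n → List (Symbol F)
  symbolsᵗ (var x)    = []
  symbolsᵗ (app f ts) = f ∷ concat (List.tabulate (λ i → symbolsᵗ (ts i)))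

  symbols : ∀ {n} → Formula F n → List (Symbol F)
  symbols (s ≐ t)    = symbolsᵗ s List.++ symbolsᵗ t
  symbols (finite t) = symbolsᵗ t
  symbols ⊤̇          = []
  symbols ⊥̇          = []
  symbols (¬̇ φ)      = symbols φ
  symbols (φ ∧̇ ψ)    = symbols φ List.++ symbols ψ
  symbols (φ ∨̇ ψ)    = symbols φ List.++ symbols ψ
  symbols (φ ⇒̇ ψ)    = symbols φ List.++ symbols ψ
  symbols (φ ⇔̇ ψ)    = symbols φ List.++ symbols ψ
  symbols (all φ)    = symbols φ
  symbols (ex φ)     = symbols φ

  weaken : ∀ {F₀ : List (Symbol F)} {d D} {M N : Structure F} {Z : Stages M N} → d ≤ D →
           PartialIsomorphism F₀ D M N Z → PartialIsomorphism F₀ d M N Z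
  weaken d≤D I = record
    { mono = mono
    ; resp = resp
    ; to   = record
      { functional = λ z z′ → functional to (mono-≤ d≤D z) (mono-≤ d≤D z′)
      ; preserves  = preserves to ∘ mono-≤ d≤D
      ; forth      = λ j<d → forth to (≤-trans j<d d≤D)
      ; range      = proj₁ (range to) , proj₂ (range to) ∘ mono-≤ d≤D
      }
    ; from = record
      { functional = λ z z′ → functional from (mono-≤ d≤D z) (mono-≤ d≤D z′)
      ; preserves  = preserves from ∘ mono-≤ d≤D
      ; forth      = λ j<d → forth from (≤-trans j<d d≤D)
      ; range      = proj₁ (range from) , proj₂ (range from) ∘ mono-≤ d≤D
      }
    }
    where open PartialIsomorphism I
          open Simulation

  emptyIsomorphism : ∀ F₀ d M N → PartialIsomorphism {F = F} F₀ d M N (λ _ _ _ → ⊥)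
  emptyIsomorphism F₀ d M N = record
    { mono = λ ()
    ; resp = λ _ _ ()
    ; to   = record { functional = λ () ; preserves = λ () ; forth = λ _ () ; range = [] , λ () }
    ; from = record { functional = λ () ; preserves = λ () ; forth = λ _ () ; range = [] , λ () }
    }

module BackAndForth {ℓ} (em : ExcludedMiddle ℓ) {F : FunctionSymbols ℓ}
                    (infinite : InfinitelyManyNonConstants F) (hasConstant : HasConstant F)
                    (F₀ : List (Symbol F)) where

  module Extend = Extension em infinite hasConstant F₀

  Relates : ∀ {n k} → Vector (Term F n) k → (d D : ℕ) → Set (Level.suc ℓ)
  Relates {n} ts d D =
    ∀ {M N : Structure F} → IsModel M → IsModel N →
    {Z : Stages M N} → PartialIsomorphism F₀ D M N Z →
    ∀ {ρ σ} → (∀ i → Z 0 (ρ i) (σ i)) →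
    Σ (Stages M N) λ Z′ → PartialIsomorphism F₀ d M N Z′ × (∀ {p q} → Z 0 p q → Z′ 0 p q) ×
      (∀ i → Z′ 0 (⟦ M ⟧ (ts i) ρ) (⟦ N ⟧ (ts i) σ))

  -- Depths are computed from the last term backwards: relating the first term must leave enough
  -- depth for the rest.
  relateAll : ∀ {n k} (ts : Vector (Term F n) k) → (∀ i d → ∃[ D ] Relates {k = 1} (λ _ → ts i) d D) →
              ∀ d → ∃[ D ] Relates ts d D
  relateAll {k = zero} ts relate d = d , λ _ _ {Z} I _ → Z , I , id , λ ()
  relateAll {k = suc k} ts relate d
    with D₁ , rest  ← relateAll (ts ∘ suc) (relate ∘ suc) d
    with D , first ← relate zero D₁ = D , λ M-model N-model I ρσ →
      let Z₁ , I₁ , ⊆₁ , z₁ = first M-model N-model I ρσ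
          Z₂ , I₂ , ⊆₂ , z₂ = rest M-model N-model I₁ (⊆₁ ∘ ρσ)
      in Z₂ , I₂ , ⊆₂ ∘ ⊆₁ , λ { zero → ⊆₂ (z₁ zero) ; (suc i) → z₂ i }

  -- For an application, relate the arguments first and then answer its value in M as a new element.
  -- `forth` decomposes the answer, and `functional` identifies the parts with the values of the
  -- arguments in N.
  relate : ∀ {n} (t : Term F n) → symbolsᵗ t ⊆ F₀ → ∀ d → ∃[ D ] Relates {k = 1} (λ _ → t) d D
  relate (var x) _ d = d , λ _ _ {Z} I ρσ → Z , I , id , λ _ → ρσ x
  relate (app f ts) ⊆F₀ d
    with D , arguments ← relateAll ts (λ i → relate (ts i) λ f∈ → ⊆F₀ (there (Any.concat⁺ (Any.tabulate⁺ i f∈))))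
                           -- Depth `suc d` guarantees the one decomposition of the answer, even for
                           -- d = 0.
                           (extensionDepth em infinite hasConstant F₀ (suc d)) =
    D , λ {M} {N} M-model N-model I {ρ} {σ} ρσ →
      let module N      = Structure N
          open Setoid N.domain using (sym; trans)
          Z₁ , I₁ , ⊆₁ , zs = arguments M-model N-model I ρσ
          module E      = Extend (suc d) M-model N-model I₁ (⟦ M ⟧ (app f ts) ρ)
          open PartialIsomorphism E.extension
          b , z         = E.extended-at-a
          bs , eq , zs′ = Simulation.forth to (s≤s z≤n) z (⊆F₀ (here ≡.refl)) (Setoid.refl (Structure.domain M))
          bs≈ts         = λ i → Simulation.functional to (mono-≤ (s≤s z≤n) (zs′ i))
                            (mono-≤ (z≤n {suc d}) (inj₁ (zs i))) (Setoid.refl (Structure.domain M))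
      in E.Extended , weaken (n≤1+n d) E.extension , inj₁ ∘ ⊆₁ ,
         λ _ → resp (Setoid.refl (Structure.domain M)) (trans eq (N.fun-cong f bs≈ts)) z

  -- Quantifying over all pairs of models lets negations and premises use the induction hypothesis
  -- for the inverse isomorphism.
  Transfers : ∀ {n} → Formula F n → ℕ → Set (Level.suc ℓ)
  Transfers {n} φ D =
    ∀ {M N : Structure F} → IsModel M → IsModel N →
    {Z : Stages M N} → PartialIsomorphism F₀ D M N Z →
    ∀ {ρ σ} → (∀ i → Z 0 (ρ i) (σ i)) → Satisfies M φ ρ → Satisfies N φ σ

  ∷-related : ∀ {A B : Set ℓ} (R R′ : A → B → Set ℓ) {n} {ρ : Vector A n} {σ : Vector B n} {a b} →
              (∀ {p q} → R p q → R′ p q) → R′ a b → (∀ i → R (ρ i) (σ i)) →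
              ∀ i → R′ ((a ∷ᵛ ρ) i) ((b ∷ᵛ σ) i)
  ∷-related R R′ R⊆R′ r ρσ zero    = r
  ∷-related R R′ R⊆R′ r ρσ (suc i) = R⊆R′ (ρσ i)

  transfer : ∀ {n} (φ : Formula F n) → symbols φ ⊆ F₀ → ∃ (Transfers φ)

  transferBoth : ∀ {n} (φ ψ : Formula F n) → symbols φ List.++ symbols ψ ⊆ F₀ →
                 ∃[ D ] Transfers φ D × Transfers ψ D
  transferBoth φ ψ ⊆F₀
    with D , h ← transfer φ (⊆F₀ ∘ ∈-++⁺ˡ)
    with E , k ← transfer ψ (⊆F₀ ∘ ∈-++⁺ʳ (symbols φ)) =
    D ⊔ E , (λ M N I → h M N (weaken (m≤m⊔n D E) I)) , (λ M N I → k M N (weaken (m≤n⊔m D E) I))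

  -- Once the values of the terms are related, atomic formulas can be compared at depth 0.
  transfer (s ≐ t) ⊆F₀
    with D , related ← relateAll (s ∷ᵛ t ∷ᵛ []ᵛ) (λ where
           zero       → relate s (⊆F₀ ∘ ∈-++⁺ˡ)
           (suc zero) → relate t (⊆F₀ ∘ ∈-++⁺ʳ (symbolsᵗ s))) 0 =
    D , λ M N I ρσ s≈t →
      let _ , J , _ , zs = related M N I ρσ
      in Simulation.functional (PartialIsomorphism.to J) (zs zero) (zs (suc zero)) s≈t
  transfer (finite t) ⊆F₀ with D , related ← relate t ⊆F₀ 0 =
    D , λ M N I ρσ → let _ , J , _ , zs = related M N I ρσ in
      Simulation.preserves (PartialIsomorphism.to J) (zs zero)
  transfer ⊤̇ _ = 0 , λ _ _ _ _ p → p
  transfer ⊥̇ _ = 0 , λ { _ _ _ _ (Level.lift ()) }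
  transfer (¬̇ φ) ⊆F₀ with D , h ← transfer φ ⊆F₀ =
    D , λ M N I ρσ p q → p (h N M (inverse I) ρσ q)
  transfer (φ ∧̇ ψ) ⊆F₀ with D , h , k ← transferBoth φ ψ ⊆F₀ =
    D , λ M N I ρσ (p , q) → h M N I ρσ p , k M N I ρσ q
  transfer (φ ∨̇ ψ) ⊆F₀ with D , h , k ← transferBoth φ ψ ⊆F₀ =
    D , λ M N I ρσ → Sum.map (h M N I ρσ) (k M N I ρσ)
  transfer (φ ⇒̇ ψ) ⊆F₀ with D , h , k ← transferBoth φ ψ ⊆F₀ =
    D , λ M N I ρσ p → k M N I ρσ ∘ p ∘ h N M (inverse I) ρσ
  transfer (φ ⇔̇ ψ) ⊆F₀ with D , h , k ← transferBoth φ ψ ⊆F₀ =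
    D , λ M N I ρσ (p , q) →
      k M N I ρσ ∘ p ∘ h N M (inverse I) ρσ , h M N I ρσ ∘ q ∘ k N M (inverse I) ρσ
  -- The new element lies in N, so the inverse isomorphism is extended, and the hypothesis is
  -- applied to the answer in M.
  transfer (all φ) ⊆F₀ with D , h ← transfer φ ⊆F₀ =
    extensionDepth em infinite hasConstant F₀ D , λ M N {Z} I ρσ p b →
      let module E = Extend D N M (inverse I) b
          a , z = E.extended-at-a
      in h M N (inverse E.extension) (∷-related (Z 0) (λ p q → E.Extended 0 q p) inj₁ z ρσ) (p a)
  transfer (ex φ) ⊆F₀ with D , h ← transfer φ ⊆F₀ =
    extensionDepth em infinite hasConstant F₀ D , λ M N {Z} I ρσ (a , p) →
      let module E = Extend D M N I a
          b , z = E.extended-at-a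
      in b , h M N E.extension (∷-related (Z 0) (E.Extended 0) inj₁ z ρσ) p

-- Elementary equivalence of models and completeness

elementarilyEquivalent : ∀ {ℓ} → ExcludedMiddle ℓ → {F : FunctionSymbols ℓ} →
  InfinitelyManyNonConstants F → HasConstant F → {M N : Structure F} → IsModel M → IsModel N →
  (φ : Proposition F) → True M φ → True N φ
elementarilyEquivalent em infinite hasConstant {M} {N} M-model N-model φ =
  -- Without free variables the game can start from the empty relation, which is a partial
  -- isomorphism of every depth.
  let D , φ-transfers = BackAndForth.transfer em infinite hasConstant (symbols φ) φ id
  in φ-transfers M-model N-model (emptyIsomorphism (symbols φ) D M N) λ ()

corollary4p7p2 : ∀ {ℓ} → ExcludedMiddle ℓ → (F : FunctionSymbols ℓ) → InfinitelyManyNonConstants F → HasConstant F →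
    (φ : Proposition F) → ((T F ⊨ φ) ⊎ (T F ⊨ (¬̇ φ))) × ¬ ((T F ⊨ φ) × (T F ⊨ (¬̇ φ)))
corollary4p7p2 em F infinite hasConstant φ = decided , λ (p , ¬p) → ¬p trees trees⊨T (p trees trees⊨T)
  where
  open TreeModel F

  trees⊨T : ∀ ψ → T F ψ → True trees ψ
  trees⊨T = isModel⇒model trees trees-isModel

  fromTrees : ∀ ψ → True trees ψ → T F ⊨ ψ
  fromTrees ψ p M M⊨T =
    elementarilyEquivalent em infinite hasConstant trees-isModel (model⇒isModel M M⊨T) ψ p

  decided : (T F ⊨ φ) ⊎ (T F ⊨ (¬̇ φ))
  decided with em {True trees φ}
  ... | yes p = inj₁ (fromTrees φ p)
  ... | no ¬p = inj₂ (fromTrees (¬̇ φ) ¬p)
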